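{- Let $n\ge1$. Let $\mathbf{B}_1=\{S_1,C_3,S_5,S_7,\dots\}$ and $\mathbf{B}_2=\{S_1,S_3,S_5,S_7,\dots\}$. Then both $\mathcal{Y}(\mathbf{B}_1)$ and $\mathcal{Y}(\mathbf{B}_2)$ are bases of $\Gamma^n$.
   Context: For a finite simple graph $G$, $X_G=\sum_{\kappa}\prod_{v}x_{\kappa(v)}$ is its chromatic symmetric function (sum over proper colorings $\kappa:V\to\{1,2,\dots\}$), $\omega$ is the involution of the algebra of symmetric functions with $\omega(p_r)=(-1)^{r-1}p_r$ where $p_r=\sum_ix_i^r$, and $Y_G=(X_G+\omega(X_G))/2$. $\Gamma=\mathbb{Q}[p_1,p_3,p_5,\dots]$ and $\Gamma^n$ is its subspace of homogeneous elements of degree $n$. $OP(n)$ is the set of partitions of $n$ into odd parts. $C_3$ is the cycle on three vertices; $S_k$ is the tree with one internal vertex and $k-1$ leaves. For a set $\mathbf{B}=\{G_1,G_3,G_5,\dots\}$ of simple graphs with $G_k$ having $k$ vertices, $\mathcal{Y}(\mathbf{B})=\{\prod_{i}Y_{G_{\lambda_i}}\,:\,\lambda\in OP(n)\}$ (here $G_1=S_1$, $G_3\in\{C_3,S_3\}$, $G_k=S_k$ for odd $k\ge5$). -}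

module Defs where

open import Data.Bool using (Bool; true; false; not; _∧_; _∨_; if_then_else_)
open import Data.Nat as ℕ using (ℕ; zero; suc; _≤_; _∸_; _≥_)
open import Data.Nat.DivMod using (_%_)
open import Data.Fin as Fin using (Fin)
open import Data.List using (List; []; _∷_; map; foldr; length; allFin; concatMap; zipWith; upTo; filterᵇ)
open import Data.Nat.ListAction using (sum)
open import Data.List.Relation.Unary.All using (All)
open import Data.List.Relation.Unary.Linked using (Linked)
open import Data.List.Relation.Unary.Unique.Propositional using (Unique)
open import Data.List.Properties using (≡-dec)
open import Data.Vec as Vec using (Vec; lookup)
open import Data.Integer using (+_)
open import Data.Rational using (ℚ; _+_; _*_; 0ℚ; 1ℚ; ½; -_; _/_)
open import Data.Product using (Σ; ∃; ∃-syntax; _×_; _,_; proj₁; proj₂)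
open import Relation.Binary.PropositionalEquality using (_≡_; refl)
open import Relation.Nullary using (does)

Odd : ℕ → Set
Odd k = k % 2 ≡ 1

isEven : ℕ → Bool
isEven k = does (k % 2 ℕ.≟ 0)

ℕtoℚ : ℕ → ℚ
ℕtoℚ k = (+ k) / 1

-- Symmetric functions (formal power series in x₁, x₂, …, over ℚ),
-- represented by their coefficient function on monomials.
-- A monomial x₁^α₁ x₂^α₂ ⋯ x_k^α_k is given by the exponent list
-- α = α₁ ∷ … ∷ α_k ∷ [] (all further exponents are 0).

Series : Set
Series = List ℕ → ℚ

infix 4 _≈_
_≈_ : Series → Series → Set
f ≈ g = ∀ α → f α ≡ g α

zeroS : Series
zeroS _ = 0ℚ

oneS : Series
oneS α = if does (sum α ℕ.≟ 0) then 1ℚ else 0ℚ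

_+S_ : Series → Series → Series
(f +S g) α = f α + g α

_·S_ : ℚ → Series → Series
(c ·S f) α = c * f α

below : List ℕ → List (List ℕ)
below [] = [] ∷ []
below (a ∷ α) = concatMap (λ b → map (b ∷_) (below α)) (upTo (suc a))

_*S_ : Series → Series → Series
(f *S g) α = foldr (λ β acc → f β * g (zipWith _∸_ α β) + acc) 0ℚ (below α)

-- power sum p_r = Σ_i x_i^r : coefficient 1 exactly on monomials x_i^r
nonzeros : List ℕ → ℕ
nonzeros = foldr (λ a acc → if does (a ℕ.≟ 0) then acc else suc acc) 0

p : ℕ → Series
p r α = if does (sum α ℕ.≟ r) ∧ does (nonzeros α ℕ.≟ 1) then 1ℚ else 0ℚ

pProd : List ℕ → Series
pProd = foldr (λ r acc → p r *S acc) oneS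

lin : List (ℚ × List ℕ) → (List ℕ → Series) → Series
lin cs b = foldr (λ cl acc → (proj₁ cl ·S b (proj₂ cl)) +S acc) zeroS cs

-- The involution ω, given by ω(p_λ) = ε_λ p_λ with ε_λ = Π (-1)^(λ_i - 1),
-- as a relation: IsOmega f g  means  g = ω(f).  (Every symmetric function
-- is a linear combination of the p_λ; any such expansion determines ω(f).)

ε : List ℕ → ℚ
ε λs = foldr (λ r acc → if isEven r then - acc else acc) 1ℚ λs

IsOmega : Series → Series → Set
IsOmega f g = ∃[ cs ] (All (λ cl → All (1 ≤_) (proj₂ cl)) cs
                      × f ≈ lin cs pProd
                      × g ≈ lin (map (λ cl → (ε (proj₂ cl) * proj₁ cl , proj₂ cl)) cs) pProd)

record Graph (m : ℕ) : Set where
  field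
    adj   : Fin m → Fin m → Bool
    sym   : ∀ u v → adj u v ≡ adj v u
    irrefl : ∀ u → adj u u ≡ false
open Graph public

allMaps : (m k : ℕ) → List (Vec (Fin k) m)
allMaps zero k = Vec.[] ∷ []
allMaps (suc m) k = concatMap (λ i → map (i Vec.∷_) (allMaps m k)) (allFin k)

allᵇ : {A : Set} → (A → Bool) → List A → Bool
allᵇ P = foldr (λ a acc → P a ∧ acc) true

proper? : ∀ {m k} → Graph m → Vec (Fin k) m → Bool
proper? {m} G κ = allᵇ (λ u → allᵇ (λ v → not (adj G u v) ∨ not (does (lookup κ u Fin.≟ lookup κ v))) (allFin m)) (allFin m)

colourCount : ∀ {m k} → Vec (Fin k) m → Fin k → ℕ
colourCount κ i = Vec.foldr (λ _ → ℕ) (λ c acc → if does (c Fin.≟ i) then suc acc else acc) 0 κ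

hasType? : ∀ {m} (α : List ℕ) → Vec (Fin (length α)) m → Bool
hasType? α κ = does (≡-dec ℕ._≟_ (map (colourCount κ) (allFin (length α))) α)

X : ∀ {m} → Graph m → Series
X {m} G α = ℕtoℚ (length (filterᵇ (λ κ → proper? G κ ∧ hasType? α κ) (allMaps m (length α))))

IsY : ∀ {m} → Graph m → Series → Set
IsY G y = ∃[ g ] (IsOmega (X G) g × y ≈ ½ ·S (X G +S g))

starAdj : ∀ {k} → Fin k → Fin k → Bool
starAdj Fin.zero Fin.zero = false
starAdj Fin.zero (Fin.suc _) = true
starAdj (Fin.suc _) Fin.zero = true
starAdj (Fin.suc _) (Fin.suc _) = false

star : (k : ℕ) → Graph k
star k = record { adj = starAdj ; sym = s ; irrefl = i }
  where
  s : ∀ (u v : Fin k) → starAdj u v ≡ starAdj v u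
  s Fin.zero Fin.zero = refl
  s Fin.zero (Fin.suc _) = refl
  s (Fin.suc _) Fin.zero = refl
  s (Fin.suc _) (Fin.suc _) = refl
  i : ∀ (u : Fin k) → starAdj u u ≡ false
  i Fin.zero = refl
  i (Fin.suc _) = refl

C3adj : Fin 3 → Fin 3 → Bool
C3adj u v = not (does (u Fin.≟ v))

C3 : Graph 3
C3 = record { adj = C3adj ; sym = s ; irrefl = i }
  where
  s : ∀ u v → C3adj u v ≡ C3adj v u
  s Fin.zero Fin.zero = refl
  s Fin.zero (Fin.suc Fin.zero) = refl
  s Fin.zero (Fin.suc (Fin.suc Fin.zero)) = refl
  s (Fin.suc Fin.zero) Fin.zero = refl
  s (Fin.suc Fin.zero) (Fin.suc Fin.zero) = refl
  s (Fin.suc Fin.zero) (Fin.suc (Fin.suc Fin.zero)) = refl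
  s (Fin.suc (Fin.suc Fin.zero)) Fin.zero = refl
  s (Fin.suc (Fin.suc Fin.zero)) (Fin.suc Fin.zero) = refl
  s (Fin.suc (Fin.suc Fin.zero)) (Fin.suc (Fin.suc Fin.zero)) = refl
  i : ∀ u → C3adj u u ≡ false
  i Fin.zero = refl
  i (Fin.suc Fin.zero) = refl
  i (Fin.suc (Fin.suc Fin.zero)) = refl

B₁ : (k : ℕ) → Graph k
B₁ 3 = C3
B₁ k = star k

B₂ : (k : ℕ) → Graph k
B₂ k = star k

OP : ℕ → List ℕ → Set
OP n λs = All Odd λs × Linked _≥_ λs × sum λs ≡ n

InSpanOP : ℕ → (List ℕ → Series) → Series → Set
InSpanOP n b f = ∃[ cs ] (All (λ cl → OP n (proj₂ cl)) cs × f ≈ lin cs b)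

-- Γⁿ : homogeneous degree-n elements of ℚ[p₁,p₃,p₅,…]
Γ : ℕ → Series → Set
Γ n = InSpanOP n pProd

IndependentOP : ℕ → (List ℕ → Series) → Set
IndependentOP n b = ∀ cs → All (λ cl → OP n (proj₂ cl)) cs → Unique (map proj₂ cs)
                    → lin cs b ≈ zeroS → All (λ cl → proj₁ cl ≡ 0ℚ) cs

IsBasisΓ : ℕ → (List ℕ → Series) → Set
IsBasisΓ n b = (∀ λs → OP n λs → Γ n (b λs))
             × (∀ f → Γ n f → InSpanOP n b f)
             × IndependentOP n b

prodY : (ℕ → Series) → List ℕ → Series
prodY Y = foldr (λ k acc → Y k *S acc) oneS

-- 𝒴(B) is well defined (each Y_{G_k}, k odd, exists) and is a basis of Γⁿ
𝒴IsBasis : ℕ → ((k : ℕ) → Graph k) → Set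
𝒴IsBasis n G = (∀ k → Odd k → ∃[ y ] IsY (G k) y)
             × (∀ (Y : ℕ → Series) → (∀ k → Odd k → IsY (G k) (Y k)) → IsBasisΓ n (prodY Y))

{-# OPTIONS --safe #-}

-- Multiplication by p_r acts on coefficient functions by lowering one exponent by r (operator P); these operators
-- commute, and p_μ = P_{μ₁} P_{μ₂} ⋯ 1. The coefficient of x^ν in p_μ vanishes unless μ is a rearrangement of ν or
-- has more parts than ν. Hence the p_μ are independent, and ω is well defined on them.
-- In a star, every leaf avoids the colour of the centre, so X = ∑_c x_c (p₁ - x_c)^m for m leaves; hence X is ±p_{m+1}
-- plus terms p_{r+1} p₁^l with l ≥ 1, and averaging with ω keeps exactly the terms with odd parts. So Y_k is a nonzero
-- multiple of p_k plus products of at least two odd power sums, the same holds for X_{C₃} = 2p₃ + p₁³ - 3p₂p₁, and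
-- consequently Y_λ is a nonzero multiple of p_λ plus p_μ's with more parts than λ: the transition is triangular.
module Submission where

open import Defs hiding (sym)
open import Data.Bool using (Bool; true; false; not; _∧_; _∨_; if_then_else_)
open import Data.Bool.Properties using (∧-identityʳ; ∧-zeroʳ; ∧-idem; if-eta)
open import Data.Fin as Fin using (Fin)
import Data.Integer as ℤ
import Data.Integer.Properties as ℤ
open import Data.List using (List; []; _∷_; _++_; length; map; foldr; filter; filterᵇ; concatMap; allFin; tabulate; replicate; upTo; applyUpTo; zipWith)
open import Data.List.Extrema.Nat using (argmax; argmax-sel; f[xs]≤f[argmax]; f[⊥]≤f[argmax])
open import Data.List.Membership.Propositional using (_∈_; lose)
open import Data.List.Properties using (≡-dec; filter-notAll; map-tabulate; length-replicate; length-++)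
open import Data.List.Relation.Binary.Permutation.Propositional as ↭ using (_↭_; ↭-sym; ↭-trans; ↭⇒↭ₛ)
open import Data.List.Relation.Binary.Permutation.Propositional.Properties using (↭-length; All-resp-↭)
open import Data.List.Relation.Binary.Pointwise using (Pointwise-≡⇒≡)
open import Data.List.Relation.Unary.All as All using (All; []; _∷_)
import Data.List.Relation.Unary.All.Properties as All
open import Data.List.Relation.Unary.AllPairs using ([]; _∷_)
open import Data.List.Relation.Unary.Any using (here; there)
open import Data.List.Relation.Unary.Linked using (Linked)
open import Data.List.Relation.Unary.Sorted.TotalOrder.Properties using (↗↭↗⇒≋)
open import Data.List.Relation.Unary.Unique.Propositional using (Unique)
open import Data.Nat as ℕ using (ℕ; zero; suc; _∸_; _≤_; _<_; _≥_; z≤n; s≤s)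
open import Data.Nat.DivMod using (_%_; m%n<n)
open import Data.Nat.ListAction using (sum)
open import Data.Nat.ListAction.Properties using (sum-++; sum-↭)
import Data.Nat.Properties as ℕ
open import Data.Product using (_×_; _,_; proj₁; proj₂; ∃-syntax)
open import Data.Rational using (ℚ; 0ℚ; 1ℚ; ½; _+_; _*_; -_; 1/_; ≢-nonZero)
import Data.Rational as ℚ using (_≤_; _<_; NonZero)
import Data.Rational.Properties as ℚ
open import Data.Rational.Solver using (module +-*-Solver)
open import Data.Rational.Unnormalised using (mkℚᵘ; *≡*)
import Data.Rational.Unnormalised.Properties as ℚᵘ
open import Data.Sum using (_⊎_; inj₁; inj₂)
open import Data.Vec using (Vec; []; _∷_; lookup; toList; fromList)
open import Data.Vec.Properties using (toList∘fromList)
open import Function using (_∘_; id)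
open import Relation.Binary using (DecTotalOrder)
open import Relation.Binary.Properties.DecTotalOrder ℕ.≤-decTotalOrder using (≥-decTotalOrder)
open import Data.List.Sort ≥-decTotalOrder using (sort; sort-↭; sort-↗)
open import Relation.Binary.PropositionalEquality using (_≡_; _≢_; refl; sym; trans; cong; cong₂; subst; module ≡-Reasoning)
open import Relation.Nullary using (does; yes; no; ¬?; contradiction)
open ≡-Reasoning
open +-*-Solver using (solve; con; _:=_; _:+_; _:*_; :-_)

-- Sums, products of series, and multiplication by power sums

-- Linear combinations arrive as lists whose indices may repeat and need not be sorted, so
-- coefficients cannot simply be read off. Relations are therefore tested by functionals:
-- `pairing cs φ` evaluates the formal combination with each index μ replaced by φ μ, and
-- independence says that a relation among the p_μ is killed by every φ that ignores the order of
-- the parts. Two choices of φ carry the rest: ε_μ times a coefficient of p_μ shows that ω does not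
-- depend on the chosen expansion, and `δ ν ∘ sort` extracts the coefficient of p_ν. The first
-- choice is forced by `IsOmega`, which only asserts that some expansion exists, while the theorem
-- speaks of every family satisfying `IsY`. The coefficient at α sees only the first `length α`
-- variables, so each chromatic identity is checked in finitely many variables, with colours in
-- `Fin (length α)`. Averaging with ω works because ε of (r+1, 1, ..., 1) is (-1)^r: such a term
-- survives exactly when all its parts are odd.

+-interchange : ∀ a b c d → (a + b) + (c + d) ≡ (a + c) + (b + d)
+-interchange = solve 4 (λ a b c d → (a :+ b) :+ (c :+ d) := (a :+ c) :+ (b :+ d)) refl

∑ : {A : Set} → List A → (A → ℚ) → ℚ
∑ []       f = 0ℚ
∑ (x ∷ xs) f = f x + ∑ xs f

foldr≡∑ : ∀ {A : Set} (f : A → ℚ) xs → foldr (λ x acc → f x + acc) 0ℚ xs ≡ ∑ xs f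
foldr≡∑ f []       = refl
foldr≡∑ f (x ∷ xs) = cong (f x +_) (foldr≡∑ f xs)

module _ {A : Set} where

  ∑-congAll : ∀ {f g : A → ℚ} {xs} → All (λ x → f x ≡ g x) xs → ∑ xs f ≡ ∑ xs g
  ∑-congAll []       = refl
  ∑-congAll (e ∷ es) = cong₂ _+_ e (∑-congAll es)

  ∑-cong : ∀ {f g : A → ℚ} xs → (∀ x → f x ≡ g x) → ∑ xs f ≡ ∑ xs g
  ∑-cong xs e = ∑-congAll (All.universal e xs)

  ∑-zero : ∀ (xs : List A) → ∑ xs (λ _ → 0ℚ) ≡ 0ℚ
  ∑-zero []       = refl
  ∑-zero (x ∷ xs) = trans (ℚ.+-identityˡ _) (∑-zero xs)

  ∑-++ : ∀ (f : A → ℚ) xs ys → ∑ (xs ++ ys) f ≡ ∑ xs f + ∑ ys f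
  ∑-++ f []       ys = sym (ℚ.+-identityˡ _)
  ∑-++ f (x ∷ xs) ys = trans (cong (f x +_) (∑-++ f xs ys)) (sym (ℚ.+-assoc (f x) _ _))

  ∑-+ : ∀ (f g : A → ℚ) xs → ∑ xs (λ x → f x + g x) ≡ ∑ xs f + ∑ xs g
  ∑-+ f g []       = refl
  ∑-+ f g (x ∷ xs) = trans (cong (f x + g x +_) (∑-+ f g xs))
    (+-interchange (f x) (g x) (∑ xs f) (∑ xs g))

  ∑-*ˡ : ∀ c (f : A → ℚ) xs → ∑ xs (λ x → c * f x) ≡ c * ∑ xs f
  ∑-*ˡ c f []       = sym (ℚ.*-zeroʳ c)
  ∑-*ˡ c f (x ∷ xs) = trans (cong (c * f x +_) (∑-*ˡ c f xs)) (sym (ℚ.*-distribˡ-+ c (f x) _))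

  ∑-*ʳ : ∀ c (f : A → ℚ) xs → ∑ xs (λ x → f x * c) ≡ ∑ xs f * c
  ∑-*ʳ c f xs = trans (∑-cong xs (λ x → ℚ.*-comm (f x) c)) (trans (∑-*ˡ c f xs) (ℚ.*-comm c _))

  ∑-map : ∀ {B : Set} (h : B → A) (f : A → ℚ) xs → ∑ (map h xs) f ≡ ∑ xs (f ∘ h)
  ∑-map h f []       = refl
  ∑-map h f (x ∷ xs) = cong (f (h x) +_) (∑-map h f xs)

  ∑-concatMap : ∀ {B : Set} (h : B → List A) (f : A → ℚ) xs →
                ∑ (concatMap h xs) f ≡ ∑ xs (λ x → ∑ (h x) f)
  ∑-concatMap h f []       = refl
  ∑-concatMap h f (x ∷ xs) = trans (∑-++ f (h x) _) (cong (∑ (h x) f +_) (∑-concatMap h f xs))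

∑-swap : ∀ {A B : Set} (f : A → B → ℚ) xs ys → ∑ xs (λ x → ∑ ys (f x)) ≡ ∑ ys (λ y → ∑ xs (λ x → f x y))
∑-swap f []       ys = sym (∑-zero ys)
∑-swap f (x ∷ xs) ys = trans (cong (∑ ys (f x) +_) (∑-swap f xs ys)) (sym (∑-+ (f x) _ ys))

∑-applyUpTo : ∀ {A : Set} (h : ℕ → A) f n → ∑ (applyUpTo h n) f ≡ ∑ (upTo n) (f ∘ h)
∑-applyUpTo h f zero    = refl
∑-applyUpTo h f (suc n) = cong (f (h 0) +_) (trans (∑-applyUpTo (h ∘ suc) f n) (sym (∑-applyUpTo suc (f ∘ h) n)))

∑-upTo-suc : ∀ f n → ∑ (upTo (suc n)) f ≡ f 0 + ∑ (upTo n) (f ∘ suc)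
∑-upTo-suc f n = cong (f 0 +_) (∑-applyUpTo suc f n)

Poly : Set
Poly = List (ℚ × List ℕ)

-- Linear extension of φ to formal combinations. With φ μ = `PP μ α` it is the coefficient at α of
-- the series that the combination denotes.
pairing : Poly → (List ℕ → ℚ) → ℚ
pairing cs φ = ∑ cs (λ cl → proj₁ cl * φ (proj₂ cl))

lin≡pairing : ∀ cs b α → lin cs b α ≡ pairing cs (λ μ → b μ α)
lin≡pairing []       b α = refl
lin≡pairing (cl ∷ cs) b α = cong (proj₁ cl * b (proj₂ cl) α +_) (lin≡pairing cs b α)

-- The coefficient of xᵃ in xʳ h, for a power series h in one variable x.
shift : ℕ → (ℕ → ℚ) → ℕ → ℚ
shift zero    h a       = h a
shift (suc r) h zero    = 0ℚ
shift (suc r) h (suc a) = shift r h a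

shift-cong : ∀ r {h k} a → (∀ b → h b ≡ k b) → shift r h a ≡ shift r k a
shift-cong zero    a       e = e a
shift-cong (suc r) zero    e = refl
shift-cong (suc r) (suc a) e = shift-cong r a e

shift-+ : ∀ r s h a → shift r (shift s h) a ≡ shift (r ℕ.+ s) h a
shift-+ zero    s h a       = refl
shift-+ (suc r) s h zero    = refl
shift-+ (suc r) s h (suc a) = shift-+ r s h a

shift-comm : ∀ r s h a → shift r (shift s h) a ≡ shift s (shift r h) a
shift-comm r s h a = begin
  shift r (shift s h) a ≡⟨ shift-+ r s h a ⟩
  shift (r ℕ.+ s) h a   ≡⟨ cong (λ t → shift t h a) (ℕ.+-comm r s) ⟩
  shift (s ℕ.+ r) h a   ≡⟨ shift-+ s r h a ⟨
  shift s (shift r h) a ∎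

shift-self : ∀ r h → shift r h r ≡ h 0
shift-self zero    h = refl
shift-self (suc r) h = shift-self r h

-- `shift` returns either one value of its argument or 0, so it commutes with any `L` that sends the
-- zero function to 0.
shift-apply : ∀ {B : Set} (L : (B → ℚ) → ℚ) → L (λ _ → 0ℚ) ≡ 0ℚ → ∀ r (g : ℕ → B → ℚ) a →
              L (λ β → shift r (λ b → g b β) a) ≡ shift r (λ b → L (g b)) a
shift-apply L L0 zero    g a       = refl
shift-apply L L0 (suc r) g zero    = L0
shift-apply L L0 (suc r) g (suc a) = shift-apply L L0 r g a

shift-∑ : ∀ {A : Set} r (f : A → ℕ → ℚ) xs a → shift r (λ b → ∑ xs (λ x → f x b)) a ≡ ∑ xs (λ x → shift r (f x) a)
shift-∑ r f xs a = sym (shift-apply (∑ xs) (∑-zero xs) r (λ b x → f x b) a)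

shift-*ˡ : ∀ r c h a → shift r (λ b → c * h b) a ≡ c * shift r h a
shift-*ˡ zero    c h a       = refl
shift-*ˡ (suc r) c h zero    = sym (ℚ.*-zeroʳ c)
shift-*ˡ (suc r) c h (suc a) = shift-*ˡ r c h a

shift-+ᶠ : ∀ r h k a → shift r (λ b → h b + k b) a ≡ shift r h a + shift r k a
shift-+ᶠ zero    h k a       = refl
shift-+ᶠ (suc r) h k zero    = refl
shift-+ᶠ (suc r) h k (suc a) = shift-+ᶠ r h k a

-- The coefficient of the b-th power of the first variable, as a series in the remaining variables.
_∂_ : Series → ℕ → Series
(f ∂ b) α = f (b ∷ α)

-- Multiplication by the power sum p_r (for r ≥ 1).
P : ℕ → Series → Series
P r g []      = 0ℚ
P r g (a ∷ α) = shift r (λ b → g (b ∷ α)) a + P r (g ∂ a) α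

P-cong : ∀ r {f g} → f ≈ g → P r f ≈ P r g
P-cong r e []      = refl
P-cong r e (a ∷ α) = cong₂ _+_ (shift-cong r a (λ b → e (b ∷ α))) (P-cong r (λ β → e (a ∷ β)) α)

P-∑ : ∀ {A : Set} r (f : A → Series) xs α → P r (λ β → ∑ xs (λ x → f x β)) α ≡ ∑ xs (λ x → P r (f x) α)
P-∑ r f xs []      = sym (∑-zero xs)
P-∑ r f xs (a ∷ α) = begin
  shift r (λ b → ∑ xs (λ x → f x (b ∷ α))) a + P r (λ β → ∑ xs (λ x → f x (a ∷ β))) α
    ≡⟨ cong₂ _+_ (shift-∑ r (λ x b → f x (b ∷ α)) xs a) (P-∑ r (λ x → f x ∂ a) xs α) ⟩
  ∑ xs (λ x → shift r (λ b → f x (b ∷ α)) a) + ∑ xs (λ x → P r (f x ∂ a) α)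
    ≡⟨ ∑-+ (λ x → shift r (λ b → f x (b ∷ α)) a) (λ x → P r (f x ∂ a) α) xs ⟨
  ∑ xs (λ x → P r (f x) (a ∷ α)) ∎

P-*ˡ : ∀ r c f α → P r (λ β → c * f β) α ≡ c * P r f α
P-*ˡ r c f []      = sym (ℚ.*-zeroʳ c)
P-*ˡ r c f (a ∷ α) = trans (cong₂ _+_ (shift-*ˡ r c _ a) (P-*ˡ r c (f ∂ a) α)) (sym (ℚ.*-distribˡ-+ c (shift r (λ b → f (b ∷ α)) a) (P r (f ∂ a) α)))

P-zero : ∀ r α → P r (λ _ → 0ℚ) α ≡ 0ℚ
P-zero r α = P-∑ r (λ (_ : ℕ) → zeroS) [] α

-- Each operator is its action on the first exponent plus its action on the others. Of the four
-- composites, the two pure ones commute by `shift-comm` and by induction; the two mixed ones touch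
-- different exponents and merely trade places.
P-comm : ∀ r s f α → P r (P s f) α ≡ P s (P r f) α
P-comm r s f []      = refl
P-comm r s f (a ∷ α) = begin
  shift r (λ b → shift s (λ c → f (c ∷ α)) b + P s (f ∂ b) α) a
    + P r (λ β → shift s (λ b → f (b ∷ β)) a + P s (f ∂ a) β) α
    ≡⟨ expand r s ⟩
  shift r (shift s (λ c → f (c ∷ α))) a + shift r (λ b → P s (f ∂ b) α) a
    + (shift s (λ b → P r (f ∂ b) α) a + P r (P s (f ∂ a)) α)
    ≡⟨ cong₂ (λ x y → x + shift r (λ b → P s (f ∂ b) α) a + (shift s (λ b → P r (f ∂ b) α) a + y))
             (shift-comm r s _ a) (P-comm r s (f ∂ a) α) ⟩
  shift s (shift r (λ c → f (c ∷ α))) a + shift r (λ b → P s (f ∂ b) α) a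
    + (shift s (λ b → P r (f ∂ b) α) a + P s (P r (f ∂ a)) α)
    ≡⟨ +-interchange (shift s (shift r (λ c → f (c ∷ α))) a) (shift r (λ b → P s (f ∂ b) α) a)
                     (shift s (λ b → P r (f ∂ b) α) a) (P s (P r (f ∂ a)) α) ⟩
  shift s (shift r (λ c → f (c ∷ α))) a + shift s (λ b → P r (f ∂ b) α) a
    + (shift r (λ b → P s (f ∂ b) α) a + P s (P r (f ∂ a)) α)
    ≡⟨ expand s r ⟨
  shift s (λ b → shift r (λ c → f (c ∷ α)) b + P r (f ∂ b) α) a
    + P s (λ β → shift r (λ b → f (b ∷ β)) a + P r (f ∂ a) β) α ∎
  where
  P-+ : ∀ r f g α → P r (λ β → f β + g β) α ≡ P r f α + P r g α
  P-+ r f g []      = refl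
  P-+ r f g (a ∷ α) = trans (cong₂ _+_ (shift-+ᶠ r (λ b → f (b ∷ α)) (λ b → g (b ∷ α)) a) (P-+ r (f ∂ a) (g ∂ a) α))
    (+-interchange (shift r (λ b → f (b ∷ α)) a) (shift r (λ b → g (b ∷ α)) a) (P r (f ∂ a) α) (P r (g ∂ a) α))
  expand : ∀ r s →
    shift r (λ b → shift s (λ c → f (c ∷ α)) b + P s (f ∂ b) α) a
      + P r (λ β → shift s (λ b → f (b ∷ β)) a + P s (f ∂ a) β) α
    ≡ shift r (shift s (λ c → f (c ∷ α))) a + shift r (λ b → P s (f ∂ b) α) a
      + (shift s (λ b → P r (f ∂ b) α) a + P r (P s (f ∂ a)) α)
  expand r s = cong₂ _+_ (shift-+ᶠ r (shift s (λ c → f (c ∷ α))) (λ b → P s (f ∂ b) α) a)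
    (trans (P-+ r (λ β → shift s (λ b → f (b ∷ β)) a) (P s (f ∂ a)) α) (cong (_+ P r (P s (f ∂ a)) α)
      (shift-apply (λ h → P r h α) (P-zero r α) s (λ b → f ∂ b) a)))

*S≡∑ : ∀ f g α → (f *S g) α ≡ ∑ (below α) (λ β → f β * g (zipWith _∸_ α β))
*S≡∑ f g α = foldr≡∑ (λ β → f β * g (zipWith _∸_ α β)) (below α)

-- The Cauchy product in the first variable alone; `oneS-*S`, `P-*S` and `p-*S` are proved by
-- induction along this recursion.
*S-∷ : ∀ f g a α → (f *S g) (a ∷ α) ≡ ∑ (upTo (suc a)) (λ b → ((f ∂ b) *S (g ∂ (a ∸ b))) α)
*S-∷ f g a α = trans (*S≡∑ f g (a ∷ α)) (trans
  (∑-concatMap (λ b → map (b ∷_) (below α)) F (upTo (suc a)))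
  (∑-cong (upTo (suc a)) (λ b → trans (∑-map (b ∷_) F (below α)) (sym (*S≡∑ (f ∂ b) (g ∂ (a ∸ b)) α)))))
  where
  F : List ℕ → ℚ
  F β = f β * g (zipWith _∸_ (a ∷ α) β)

*S-cong : ∀ {f f′ g g′} → f ≈ f′ → g ≈ g′ → (f *S g) ≈ (f′ *S g′)
*S-cong {f} {f′} {g} {g′} e e′ α = trans (*S≡∑ f g α)
  (trans (∑-cong (below α) (λ β → cong₂ _*_ (e β) (e′ (zipWith _∸_ α β)))) (sym (*S≡∑ f′ g′ α)))

*S-linˡ : ∀ {A : Set} (c : A → ℚ) (f : A → Series) xs g α →
          ((λ β → ∑ xs (λ x → c x * f x β)) *S g) α ≡ ∑ xs (λ x → c x * (f x *S g) α)
*S-linˡ c f xs g α = begin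
  ((λ β → ∑ xs (λ x → c x * f x β)) *S g) α
    ≡⟨ *S≡∑ (λ β → ∑ xs (λ x → c x * f x β)) g α ⟩
  ∑ (below α) (λ β → ∑ xs (λ x → c x * f x β) * g (zipWith _∸_ α β))
    ≡⟨ ∑-cong (below α) (λ β → trans (sym (∑-*ʳ (g (zipWith _∸_ α β)) (λ x → c x * f x β) xs))
         (∑-cong xs (λ x → ℚ.*-assoc (c x) (f x β) (g (zipWith _∸_ α β))))) ⟩
  ∑ (below α) (λ β → ∑ xs (λ x → c x * (f x β * g (zipWith _∸_ α β))))
    ≡⟨ ∑-swap (λ β x → c x * (f x β * g (zipWith _∸_ α β))) (below α) xs ⟩
  ∑ xs (λ x → ∑ (below α) (λ β → c x * (f x β * g (zipWith _∸_ α β))))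
    ≡⟨ ∑-cong xs (λ x → trans (∑-*ˡ (c x) (λ β → f x β * g (zipWith _∸_ α β)) (below α))
                              (cong (c x *_) (sym (*S≡∑ (f x) g α)))) ⟩
  ∑ xs (λ x → c x * (f x *S g) α) ∎

*S-+ˡ : ∀ f f′ g α → ((f +S f′) *S g) α ≡ (f *S g) α + (f′ *S g) α
*S-+ˡ f f′ g α = begin
  ((f +S f′) *S g) α   ≡⟨ *S≡∑ (f +S f′) g α ⟩
  ∑ (below α) (λ β → (f β + f′ β) * g (zipWith _∸_ α β))
    ≡⟨ ∑-cong (below α) (λ β → ℚ.*-distribʳ-+ (g (zipWith _∸_ α β)) (f β) (f′ β)) ⟩
  ∑ (below α) (λ β → f β * g (zipWith _∸_ α β) + f′ β * g (zipWith _∸_ α β))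
    ≡⟨ ∑-+ (λ β → f β * g (zipWith _∸_ α β)) (λ β → f′ β * g (zipWith _∸_ α β)) (below α) ⟩
  ∑ (below α) (λ β → f β * g (zipWith _∸_ α β)) + ∑ (below α) (λ β → f′ β * g (zipWith _∸_ α β))
    ≡⟨ cong₂ _+_ (*S≡∑ f g α) (*S≡∑ f′ g α) ⟨
  (f *S g) α + (f′ *S g) α ∎

*S-zeroˡ : ∀ g α → (zeroS *S g) α ≡ 0ℚ
*S-zeroˡ g α = trans (*S≡∑ zeroS g α) (trans (∑-cong (below α) (λ β → ℚ.*-zeroˡ (g (zipWith _∸_ α β)))) (∑-zero (below α)))

oneS-*S : ∀ g → (oneS *S g) ≈ g
oneS-*S g []      = trans (ℚ.+-identityʳ _) (ℚ.*-identityˡ _)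
oneS-*S g (a ∷ α) = begin
  (oneS *S g) (a ∷ α)                                          ≡⟨ *S-∷ oneS g a α ⟩
  ∑ (upTo (suc a)) (λ b → ((oneS ∂ b) *S (g ∂ (a ∸ b))) α)     ≡⟨ ∑-upTo-suc (λ b → ((oneS ∂ b) *S (g ∂ (a ∸ b))) α) a ⟩
  (oneS *S (g ∂ a)) α + ∑ (upTo a) (λ b → (zeroS *S (g ∂ (a ∸ suc b))) α)
    ≡⟨ cong₂ _+_ (oneS-*S (g ∂ a) α) (trans (∑-cong (upTo a) (λ b → *S-zeroˡ (g ∂ (a ∸ suc b)) α)) (∑-zero (upTo a))) ⟩
  g (a ∷ α) + 0ℚ                                               ≡⟨ ℚ.+-identityʳ _ ⟩
  g (a ∷ α)                                                    ∎

-- Convolution in one variable x: `K b d` stands for the product of the b-th and d-th coefficients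
-- of two factors, and xʳ may be moved from the first factor to the whole product.
∑-shift : ∀ r (K : ℕ → ℕ → ℚ) a →
  ∑ (upTo (suc a)) (λ b → shift r (λ b′ → K b′ (a ∸ b)) b) ≡ shift r (λ a′ → ∑ (upTo (suc a′)) (λ b → K b (a′ ∸ b))) a
∑-shift zero    K a       = refl
∑-shift (suc r) K zero    = refl
∑-shift (suc r) K (suc a) = trans (∑-upTo-suc (λ b → shift (suc r) (λ b′ → K b′ (suc a ∸ b)) b) (suc a))
  (trans (ℚ.+-identityˡ (∑ (upTo (suc a)) (λ b → shift r (λ b′ → K b′ (a ∸ b)) b))) (∑-shift r K a))

P-*S : ∀ r f g α → (P r f *S g) α ≡ P r (f *S g) α
P-*S r f g []      = trans (ℚ.+-identityʳ _) (ℚ.*-zeroˡ (g []))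
P-*S r f g (a ∷ α) = begin
  (P r f *S g) (a ∷ α)                     ≡⟨ *S-∷ (P r f) g a α ⟩
  ∑ (upTo (suc a)) (λ b → ((P r f ∂ b) *S (g ∂ (a ∸ b))) α)
    ≡⟨ ∑-cong (upTo (suc a)) (λ b → trans
         (*S-+ˡ (λ β → shift r (λ c → f (c ∷ β)) b) (P r (f ∂ b)) (g ∂ (a ∸ b)) α)
         (cong₂ _+_ (shift-apply (λ h → (h *S (g ∂ (a ∸ b))) α) (*S-zeroˡ (g ∂ (a ∸ b)) α) r (λ c → f ∂ c) b)
                    (P-*S r (f ∂ b) (g ∂ (a ∸ b)) α))) ⟩
  ∑ (upTo (suc a)) (λ b → shift r (λ c → ((f ∂ c) *S (g ∂ (a ∸ b))) α) b + P r ((f ∂ b) *S (g ∂ (a ∸ b))) α)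
    ≡⟨ ∑-+ (λ b → shift r (λ c → ((f ∂ c) *S (g ∂ (a ∸ b))) α) b) (λ b → P r ((f ∂ b) *S (g ∂ (a ∸ b))) α) (upTo (suc a)) ⟩
  ∑ (upTo (suc a)) (λ b → shift r (λ c → ((f ∂ c) *S (g ∂ (a ∸ b))) α) b)
    + ∑ (upTo (suc a)) (λ b → P r ((f ∂ b) *S (g ∂ (a ∸ b))) α)
    ≡⟨ cong₂ _+_
         (trans (∑-shift r (λ c d → ((f ∂ c) *S (g ∂ d)) α) a) (shift-cong r a (λ d → sym (*S-∷ f g d α))))
         (trans (sym (P-∑ r (λ b → (f ∂ b) *S (g ∂ (a ∸ b))) (upTo (suc a)) α)) (P-cong r (λ β → sym (*S-∷ f g a β)) α)) ⟩
  P r (f *S g) (a ∷ α) ∎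

∑-δ : ∀ r (h : ℕ → ℚ) a →
      ∑ (upTo a) (λ b → if does (b ℕ.≟ r) then h (a ∸ suc b) else 0ℚ) ≡ shift (suc r) h a
∑-δ r       h zero    = refl
∑-δ zero    h (suc a) = trans (∑-upTo-suc (λ b → if does (b ℕ.≟ 0) then h (suc a ∸ suc b) else 0ℚ) a) (trans (cong (h a +_) (∑-zero (upTo a))) (ℚ.+-identityʳ (h a)))
∑-δ (suc r) h (suc a) = trans (∑-upTo-suc (λ b → if does (b ℕ.≟ suc r) then h (suc a ∸ suc b) else 0ℚ) a)
  (trans (ℚ.+-identityˡ (∑ (upTo a) (λ b → if does (b ℕ.≟ r) then h (a ∸ suc b) else 0ℚ))) (∑-δ r h a))

nonzeros-sum : ∀ α → does (nonzeros α ℕ.≟ 0) ≡ does (sum α ℕ.≟ 0)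
nonzeros-sum []          = refl
nonzeros-sum (zero  ∷ α) = nonzeros-sum α
nonzeros-sum (suc a ∷ α) = refl

p-∷ : ∀ r b β → p (suc r) (suc b ∷ β) ≡ (if does (b ℕ.≟ r) then oneS β else 0ℚ)
p-∷ r b β rewrite nonzeros-sum β with sum β
... | zero  rewrite ℕ.+-identityʳ b | ∧-identityʳ (does (b ℕ.≟ r)) = refl
... | suc s rewrite ∧-zeroʳ (does (b ℕ.+ suc s ℕ.≟ r)) = sym (if-eta (does (b ℕ.≟ r)))

-- Split by the exponent that `p (suc r)` receives in the first variable: 0 leaves the same power
-- sum in the remaining variables, and a positive exponent must be r + 1, with nothing left for the
-- others.
p-*S : ∀ r g → (p (suc r) *S g) ≈ P (suc r) g
p-*S r g []      = trans (ℚ.+-identityʳ _) (ℚ.*-zeroˡ (g []))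
p-*S r g (a ∷ α) = begin
  (p (suc r) *S g) (a ∷ α)     ≡⟨ *S-∷ (p (suc r)) g a α ⟩
  ∑ (upTo (suc a)) (λ b → ((p (suc r) ∂ b) *S (g ∂ (a ∸ b))) α)
    ≡⟨ ∑-upTo-suc (λ b → ((p (suc r) ∂ b) *S (g ∂ (a ∸ b))) α) a ⟩
  (p (suc r) *S (g ∂ a)) α + ∑ (upTo a) (λ b → ((p (suc r) ∂ suc b) *S (g ∂ (a ∸ suc b))) α)
    ≡⟨ cong₂ _+_ (p-*S r (g ∂ a) α) (trans (∑-cong (upTo a) step) (∑-δ r (λ b → g (b ∷ α)) a)) ⟩
  P (suc r) (g ∂ a) α + shift (suc r) (λ b → g (b ∷ α)) a
    ≡⟨ ℚ.+-comm (P (suc r) (g ∂ a) α) (shift (suc r) (λ b → g (b ∷ α)) a) ⟩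
  P (suc r) g (a ∷ α)    ∎
  where
  step : ∀ b → ((p (suc r) ∂ suc b) *S (g ∂ (a ∸ suc b))) α ≡ (if does (b ℕ.≟ r) then g ((a ∸ suc b) ∷ α) else 0ℚ)
  step b = trans (*S-cong {g = g ∂ (a ∸ suc b)} (p-∷ r b) (λ _ → refl) α) (cases (does (b ℕ.≟ r)))
    where
    cases : ∀ t → ((λ β → if t then oneS β else 0ℚ) *S (g ∂ (a ∸ suc b))) α ≡ (if t then g ((a ∸ suc b) ∷ α) else 0ℚ)
    cases true  = oneS-*S (g ∂ (a ∸ suc b)) α
    cases false = *S-zeroˡ (g ∂ (a ∸ suc b)) α

-- Products of power sums as composed operators

PP : List ℕ → Series
PP = foldr P oneS

Positive : List ℕ → Set
Positive = All (1 ≤_)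

-- A part 0 would break the agreement: `p 0` is the zero series, whereas `P 0` multiplies the
-- coefficient at α by the length of α.
pProd≈PP : ∀ {μ} → Positive μ → pProd μ ≈ PP μ
pProd≈PP []                      α = refl
pProd≈PP {suc r ∷ μ} (_ ∷ pos) α =
  trans (*S-cong {p (suc r)} (λ _ → refl) (pProd≈PP pos) α) (p-*S r (PP μ) α)

lin≡pairingPP : ∀ {cs} → All (λ cl → Positive (proj₂ cl)) cs → ∀ α → lin cs pProd α ≡ pairing cs (λ μ → PP μ α)
lin≡pairingPP {cs} pos α = trans (lin≡pairing cs pProd α)
  (∑-congAll (All.map (λ {cl} q → cong (proj₁ cl *_) (pProd≈PP q α)) pos))

PP-↭ : ∀ {μ ν} → μ ↭ ν → PP μ ≈ PP ν
PP-↭ ↭.refl           α = refl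
PP-↭ (↭.prep r e)     α = P-cong r (PP-↭ e) α
PP-↭ (↭.swap r s e)   α = trans (P-cong r (P-cong s (PP-↭ e)) α) (P-comm r s _ α)
PP-↭ (↭.trans e e′)   α = trans (PP-↭ e α) (PP-↭ e′ α)

PP-*S : ∀ μ g → (PP μ *S g) ≈ foldr P g μ
PP-*S []      g α = oneS-*S g α
PP-*S (r ∷ μ) g α = trans (P-*S r (PP μ) g α) (P-cong r (PP-*S μ g) α)

foldr-P-pairing : ∀ μ cs α → foldr P (λ β → pairing cs (λ ν → PP ν β)) μ α ≡ pairing cs (λ ν → PP (μ ++ ν) α)
foldr-P-pairing []      cs α = refl
foldr-P-pairing (r ∷ μ) cs α = trans (P-cong r (foldr-P-pairing μ cs) α)
  (trans (P-∑ r (λ cl β → proj₁ cl * PP (μ ++ proj₂ cl) β) cs α)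
         (∑-cong cs (λ cl → P-*ˡ r (proj₁ cl) (PP (μ ++ proj₂ cl)) α)))

foldr-P-cong : ∀ μ {f g} → f ≈ g → foldr P f μ ≈ foldr P g μ
foldr-P-cong []      e = e
foldr-P-cong (r ∷ μ) e = P-cong r (foldr-P-cong μ e)

-- Independence of the power sum products

_≟ᴸ_ = ≡-dec ℕ._≟_

δ : List ℕ → List ℕ → ℚ
δ ν μ = if does (μ ≟ᴸ ν) then 1ℚ else 0ℚ

δ-refl : ∀ ν → δ ν ν ≡ 1ℚ
δ-refl ν with ν ≟ᴸ ν
... | yes _  = refl
... | no ν≢ν = contradiction refl ν≢ν

δ-≢ : ∀ {ν μ} → μ ≢ ν → δ ν μ ≡ 0ℚ
δ-≢ {ν} {μ} μ≢ν with μ ≟ᴸ ν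
... | yes e = contradiction e μ≢ν
... | no _  = refl

*-cancel-≢0 : ∀ {a k} → a ≢ 0ℚ → a * k ≡ 0ℚ → k ≡ 0ℚ
*-cancel-≢0 {a} {k} a≢0 ak≡0 = begin
  k                ≡⟨ ℚ.*-identityˡ k ⟨
  1ℚ * k           ≡⟨ cong (_* k) (ℚ.*-inverseˡ a) ⟨
  1/ a * a * k     ≡⟨ ℚ.*-assoc (1/ a) a k ⟩
  1/ a * (a * k)   ≡⟨ cong (1/ a *_) ak≡0 ⟩
  1/ a * 0ℚ        ≡⟨ ℚ.*-zeroʳ (1/ a) ⟩
  0ℚ               ∎
  where
  instance a-nonZero : ℚ.NonZero a
           a-nonZero = ≢-nonZero a≢0

without : List ℕ → Poly → Poly
without ν = filter (¬? ∘ (_≟ᴸ ν) ∘ proj₂)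

-- `pairing cs (δ ν)` is the total coefficient of ν, gathered over all its repetitions in the list.
pairing-extract : ∀ ν φ cs → pairing cs φ ≡ φ ν * pairing cs (δ ν) + pairing (without ν cs) φ
pairing-extract ν φ []             = solve 1 (λ x → con 0ℚ := x :* con 0ℚ :+ con 0ℚ) refl (φ ν)
pairing-extract ν φ ((c , μ) ∷ cs) with μ ≟ᴸ ν
... | yes refl = trans (cong (c * φ ν +_) (pairing-extract ν φ cs))
  (solve 4 (λ c x k w → c :* x :+ (x :* k :+ w) := x :* (c :* con 1ℚ :+ k) :+ w) refl
    c (φ ν) (pairing cs (δ ν)) (pairing (without ν cs) φ))
... | no _     = trans (cong (c * φ μ +_) (pairing-extract ν φ cs))
  (solve 5 (λ c y x k w → c :* y :+ (x :* k :+ w) := x :* (c :* con 0ℚ :+ k) :+ (c :* y :+ w)) refl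
    c (φ μ) (φ ν) (pairing cs (δ ν)) (pairing (without ν cs) φ))

-- Abstract triangular elimination. It is used twice: for the coefficients of the p_μ, ranked by
-- length, and for the passage from the Y_μ to the p_μ, ranked by n minus length. A conclusion for
-- all φ says that the combination vanishes once like terms are collected.
module _ (Good : List ℕ → Set) (M : List ℕ → List ℕ → ℚ) (rank : List ℕ → ℕ)
         (diagonal : ∀ {ν} → Good ν → M ν ν ≢ 0ℚ)
         (triangular : ∀ {ν μ} → Good ν → Good μ → M ν μ ≢ 0ℚ → μ ≡ ν ⊎ rank ν < rank μ)
  where

  private
    -- An index of maximal rank pairs only with itself, so its total coefficient vanishes and it can be removed.
    go : ∀ N cs → length cs ≤ N → All (Good ∘ proj₂) cs → (∀ {ν} → Good ν → pairing cs (M ν) ≡ 0ℚ) →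
         ∀ φ → pairing cs φ ≡ 0ℚ
    go N       []         _     _    _      φ = refl
    go (suc N) cs@(x ∷ xs) len≤N good paired φ = trans (drop φ)
      (go N (without ν cs)
          -- The length bound `N` drives the recursion: `top` itself has index ν, so the filter
          -- removes at least one entry.
          (ℕ.≤-pred (ℕ.≤-trans (filter-notAll (¬? ∘ (_≟ᴸ ν) ∘ proj₂) cs (lose top∈cs (λ ν≢ν → ν≢ν refl))) len≤N))
          (All.filter⁺ (¬? ∘ (_≟ᴸ ν) ∘ proj₂) good)
          (λ {κ} gκ → trans (sym (drop (M κ))) (paired gκ)) φ)
      where
      top = argmax (rank ∘ proj₂) x xs
      ν   = proj₂ top
      top∈cs : top ∈ cs
      top∈cs with argmax-sel (rank ∘ proj₂) x xs
      ... | inj₁ e = here e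
      ... | inj₂ i = there i
      good-ν : Good ν
      good-ν = All.lookup good top∈cs
      rank≤ : All (λ cl → rank (proj₂ cl) ≤ rank ν) cs
      rank≤ = f[⊥]≤f[argmax] {f = rank ∘ proj₂} x xs ∷ f[xs]≤f[argmax] {f = rank ∘ proj₂} x xs
      only-ν : ∀ cl → Good (proj₂ cl) × rank (proj₂ cl) ≤ rank ν →
               proj₁ cl * M ν (proj₂ cl) ≡ M ν ν * (proj₁ cl * δ ν (proj₂ cl))
      only-ν (c , μ) (gμ , r≤) with μ ≟ᴸ ν | M ν μ ℚ.≟ 0ℚ
      ... | yes refl | _       = solve 2 (λ c m → c :* m := m :* (c :* con 1ℚ)) refl c (M ν ν)
      ... | no _     | yes M≡0 rewrite M≡0 = solve 2 (λ c m → c :* con 0ℚ := m :* (c :* con 0ℚ)) refl c (M ν ν)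
      ... | no μ≢ν   | no M≢0 with triangular good-ν gμ M≢0
      ...   | inj₁ μ≡ν = contradiction μ≡ν μ≢ν
      ...   | inj₂ r<  = contradiction r≤ (ℕ.<⇒≱ r<)
      coeff≡0 : pairing cs (δ ν) ≡ 0ℚ
      coeff≡0 = *-cancel-≢0 (diagonal good-ν) (trans (sym (∑-*ˡ (M ν ν) (λ cl → proj₁ cl * δ ν (proj₂ cl)) cs))
        (trans (sym (∑-congAll (All.zipWith (λ {cl} → only-ν cl) (good , rank≤)))) (paired good-ν)))
      drop : ∀ φ → pairing cs φ ≡ pairing (without ν cs) φ
      drop φ = trans (pairing-extract ν φ cs)
        (trans (cong (λ k → φ ν * k + pairing (without ν cs) φ) coeff≡0)
          (solve 2 (λ x w → x :* con 0ℚ :+ w := w) refl (φ ν) (pairing (without ν cs) φ)))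

  triangular⇒pairing≡0 : ∀ {cs} → All (Good ∘ proj₂) cs → (∀ {ν} → Good ν → pairing cs (M ν) ≡ 0ℚ) →
                         ∀ φ → pairing cs φ ≡ 0ℚ
  triangular⇒pairing≡0 {cs} = go (length cs) cs ℕ.≤-refl

-- Monomials that occur in a product of power sums

data Step (r : ℕ) : List ℕ → List ℕ → Set where
  here  : ∀ {b α} → Step r (b ∷ α) (r ℕ.+ b ∷ α)
  there : ∀ {a β α} → Step r β α → Step r (a ∷ β) (a ∷ α)

shift-≢0 : ∀ r h a → shift r h a ≢ 0ℚ → ∃[ b ] (r ℕ.+ b ≡ a × h b ≢ 0ℚ)
shift-≢0 zero    h a       ≢0 = a , refl , ≢0
shift-≢0 (suc r) h zero    ≢0 = contradiction refl ≢0
shift-≢0 (suc r) h (suc a) ≢0 with b , e , hb≢0 ← shift-≢0 r h a ≢0 = b , cong suc e , hb≢0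

+-≢0 : ∀ x y → x + y ≢ 0ℚ → x ≢ 0ℚ ⊎ y ≢ 0ℚ
+-≢0 x y ≢0 with x ℚ.≟ 0ℚ
... | no x≢0   = inj₁ x≢0
... | yes refl = inj₂ (λ { refl → ≢0 refl })

P-≢0 : ∀ r g α → P r g α ≢ 0ℚ → ∃[ β ] (Step r β α × g β ≢ 0ℚ)
P-≢0 r g []      ≢0 = contradiction refl ≢0
P-≢0 r g (a ∷ α) ≢0 with +-≢0 (shift r (λ b → g (b ∷ α)) a) (P r (g ∂ a) α) ≢0
... | inj₁ s≢0 with b , refl , gb≢0 ← shift-≢0 r _ a s≢0 = b ∷ α , here , gb≢0
... | inj₂ p≢0 with β , st , gβ≢0 ← P-≢0 r (g ∂ a) α p≢0 = a ∷ β , there st , gβ≢0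

nzs : List ℕ → List ℕ
nzs []          = []
nzs (zero  ∷ α) = nzs α
nzs (suc a ∷ α) = suc a ∷ nzs α

nzs-positive : ∀ {α} → Positive α → nzs α ≡ α
nzs-positive []                     = refl
nzs-positive {suc a ∷ α} (_ ∷ pos) = cong (suc a ∷_) (nzs-positive pos)

Step-nzs : ∀ {r β α} → Step (suc r) β α → nzs α ↭ suc r ∷ nzs β ⊎ length (nzs α) ≡ length (nzs β)
Step-nzs {r} (here {zero} {α}) rewrite ℕ.+-identityʳ r = inj₁ ↭.refl
Step-nzs (here {suc b})        = inj₂ refl
Step-nzs (there {zero} st)     = Step-nzs st
Step-nzs (there {suc a} st) with Step-nzs st
... | inj₁ e = inj₁ (↭-trans (↭.prep (suc a) e) (↭.swap (suc a) _ ↭.refl))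
... | inj₂ e = inj₂ (cong suc e)

oneS-≢0 : ∀ α → oneS α ≢ 0ℚ → nzs α ≡ []
oneS-≢0 []          _  = refl
oneS-≢0 (zero  ∷ α) ≢0 = oneS-≢0 α ≢0
oneS-≢0 (suc a ∷ α) ≢0 = contradiction refl ≢0

-- Every factor of p_μ selects a variable. If the selected variables are distinct, the exponents are
-- the parts of μ; any coincidence merges parts and leaves fewer of them.
PP-≢0 : ∀ {μ} → Positive μ → ∀ α → PP μ α ≢ 0ℚ → nzs α ↭ μ ⊎ length (nzs α) < length μ
PP-≢0 []                      α ≢0 = inj₁ (↭.↭-reflexive (oneS-≢0 α ≢0))
PP-≢0 {suc r ∷ μ} (_ ∷ pos) α ≢0 with β , st , gβ≢0 ← P-≢0 (suc r) (PP μ) α ≢0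
  with Step-nzs st | PP-≢0 pos β gβ≢0
... | inj₁ e | inj₁ e′ = inj₁ (↭-trans e (↭.prep (suc r) e′))
... | inj₁ e | inj₂ l  = inj₂ (subst (_< suc (length μ)) (sym (↭-length e)) (s≤s l))
... | inj₂ e | inj₁ e′ = inj₂ (s≤s (ℕ.≤-reflexive (trans e (↭-length e′))))
... | inj₂ e | inj₂ l  = inj₂ (ℕ.m<n⇒m<1+n (subst (_< length μ) (sym e) l))

shift-≥0 : ∀ r h a → (∀ b → 0ℚ ℚ.≤ h b) → 0ℚ ℚ.≤ shift r h a
shift-≥0 zero    h a       h≥0 = h≥0 a
shift-≥0 (suc r) h zero    h≥0 = ℚ.≤-refl
shift-≥0 (suc r) h (suc a) h≥0 = shift-≥0 r h a h≥0

P-≥0 : ∀ r g → (∀ α → 0ℚ ℚ.≤ g α) → ∀ α → 0ℚ ℚ.≤ P r g α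
P-≥0 r g g≥0 []      = ℚ.≤-refl
P-≥0 r g g≥0 (a ∷ α) = ℚ.+-mono-≤ (shift-≥0 r _ a (λ b → g≥0 (b ∷ α))) (P-≥0 r (g ∂ a) (λ β → g≥0 (a ∷ β)) α)

PP-≥0 : ∀ μ α → 0ℚ ℚ.≤ PP μ α
PP-≥0 []      α with does (sum α ℕ.≟ 0)
... | true  = ℚ.<⇒≤ (ℚ.positive⁻¹ 1ℚ)
... | false = ℚ.≤-refl
PP-≥0 (r ∷ μ) α = P-≥0 r (PP μ) (PP-≥0 μ) α

PP-0∷ : ∀ {μ} → Positive μ → ∀ α → PP μ (0 ∷ α) ≡ PP μ α
PP-0∷ []                      α = refl
PP-0∷ {suc r ∷ μ} (_ ∷ pos) α = trans (ℚ.+-identityˡ (P (suc r) (PP μ ∂ 0) α)) (P-cong (suc r) (PP-0∷ pos) α)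

-- The exact value counts the permutations fixing μ, but positivity suffices: all contributions are
-- nonnegative, and placing the i-th factor in the i-th variable contributes a positive one.
PP-self-≢0 : ∀ {μ} → Positive μ → PP μ μ ≢ 0ℚ
PP-self-≢0 pos = ℚ.<⇒≢ (self>0 pos) ∘ sym
  where
  self>0 : ∀ {μ} → Positive μ → 0ℚ ℚ.< PP μ μ
  self>0 []                  = ℚ.positive⁻¹ 1ℚ
  self>0 {r ∷ μ} (_ ∷ pos) = ℚ.+-mono-<-≤
    (subst (0ℚ ℚ.<_) (sym (trans (shift-self r _) (PP-0∷ pos μ))) (self>0 pos))
    (P-≥0 r (PP μ ∂ r) (λ β → PP-≥0 μ (r ∷ β)) μ)

Decreasing : List ℕ → Set
Decreasing = Linked _≥_

decreasing-↭⇒≡ : ∀ {μ ν} → Decreasing μ → Decreasing ν → μ ↭ ν → μ ≡ ν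
decreasing-↭⇒≡ ↘μ ↘ν e = Pointwise-≡⇒≡ (↗↭↗⇒≋ (DecTotalOrder.totalOrder ≥-decTotalOrder) ↘μ ↘ν (↭⇒↭ₛ e))

-- `sort` is instantiated with the reversed order on ℕ, so its output is decreasing, as `OP`
-- demands.
sort-id : ∀ {μ} → Decreasing μ → sort μ ≡ μ
sort-id {μ} ↘μ = decreasing-↭⇒≡ (sort-↗ μ) ↘μ (sort-↭ μ)

sortTerms : Poly → Poly
sortTerms = map (λ cl → proj₁ cl , sort (proj₂ cl))

pairing-sortTerms : ∀ cs φ → (∀ μ → φ (sort μ) ≡ φ μ) → pairing (sortTerms cs) φ ≡ pairing cs φ
pairing-sortTerms cs φ inv = trans (∑-map _ _ cs) (∑-cong cs (λ cl → cong (proj₁ cl *_) (inv (proj₂ cl))))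

-- Algebraic independence of the power sums: a linear relation among the p_μ is a formal consequence of commutativity.
pProd-independent : ∀ {cs} → All (Positive ∘ proj₂) cs → (∀ α → pairing cs (λ μ → PP μ α) ≡ 0ℚ) →
                    ∀ φ → (∀ μ → φ (sort μ) ≡ φ μ) → pairing cs φ ≡ 0ℚ
pProd-independent {cs} pos rel φ inv = trans (sym (pairing-sortTerms cs φ inv))
  (triangular⇒pairing≡0 Good (λ ν μ → PP μ ν) length
    (λ g → PP-self-≢0 (proj₁ g)) tri
    (All.map⁺ (All.map (λ {cl} q → All-resp-↭ (↭-sym (sort-↭ (proj₂ cl))) q , sort-↗ (proj₂ cl)) pos))
    (λ {ν} _ → trans (pairing-sortTerms cs (λ μ → PP μ ν) (λ μ → PP-↭ (sort-↭ μ) ν)) (rel ν)) φ)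
  where
  Good : List ℕ → Set
  Good μ = Positive μ × Decreasing μ
  tri : ∀ {ν μ} → Good ν → Good μ → PP μ ν ≢ 0ℚ → μ ≡ ν ⊎ length ν < length μ
  tri {ν} (posν , ↘ν) (posμ , ↘μ) ≢0 with PP-≢0 posμ ν ≢0
  ... | inj₁ e rewrite nzs-positive posν = inj₁ (decreasing-↭⇒≡ ↘μ ↘ν (↭-sym e))
  ... | inj₂ l rewrite nzs-positive posν = inj₂ l

-- Chromatic symmetric functions of stars and of the triangle

𝟙 : Bool → ℚ
𝟙 b = if b then 1ℚ else 0ℚ

𝟙-∧ : ∀ a b → 𝟙 (a ∧ b) ≡ 𝟙 a * 𝟙 b
𝟙-∧ true  b = sym (ℚ.*-identityˡ (𝟙 b))
𝟙-∧ false b = sym (ℚ.*-zeroˡ (𝟙 b))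

ℕtoℚ-suc : ∀ n → ℕtoℚ (suc n) ≡ 1ℚ + ℕtoℚ n
ℕtoℚ-suc n = ℚ.toℚᵘ-injective
  (≃-trans (ℚ.toℚᵘ-fromℚᵘ (mkℚᵘ (ℤ.+ suc n) 0))
  (≃-trans (*≡* (cong (λ t → (ℤ.+ 1 ℤ.+ t) ℤ.* ℤ.+ 1) (sym (ℤ.*-identityʳ (ℤ.+ n)))))
  (≃-trans (ℚᵘ.+-congʳ (mkℚᵘ (ℤ.+ 1) 0) (≃-sym (ℚ.toℚᵘ-fromℚᵘ (mkℚᵘ (ℤ.+ n) 0))))
           (≃-sym (ℚ.toℚᵘ-homo-+ 1ℚ (ℕtoℚ n))))))
  where open ℚᵘ using (≃-trans; ≃-sym)

ℕtoℚ-length-filterᵇ : ∀ {A : Set} (b : A → Bool) xs → ℕtoℚ (length (filterᵇ b xs)) ≡ ∑ xs (𝟙 ∘ b)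
ℕtoℚ-length-filterᵇ b []       = refl
ℕtoℚ-length-filterᵇ b (x ∷ xs) with b x
... | true  = trans (ℕtoℚ-suc (length (filterᵇ b xs))) (cong (1ℚ +_) (ℕtoℚ-length-filterᵇ b xs))
... | false = trans (ℕtoℚ-length-filterᵇ b xs) (sym (ℚ.+-identityˡ (∑ xs (𝟙 ∘ b))))

∑-tabulate : ∀ {A : Set} {n} (h : Fin n → A) f → ∑ (tabulate h) f ≡ ∑ (allFin n) (f ∘ h)
∑-tabulate {n = zero}  h f = refl
∑-tabulate {n = suc n} h f = cong (f (h Fin.zero) +_)
  (trans (∑-tabulate (h ∘ Fin.suc) f) (sym (∑-tabulate Fin.suc (f ∘ h))))

∑-allFin-suc : ∀ {n} (f : Fin (suc n) → ℚ) → ∑ (allFin (suc n)) f ≡ f Fin.zero + ∑ (allFin n) (f ∘ Fin.suc)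
∑-allFin-suc f = cong (f Fin.zero +_) (∑-tabulate Fin.suc f)

_≠ᵇ_ : ∀ {k} → Fin k → Fin k → Bool
i ≠ᵇ j = not (does (i Fin.≟ j))

≠ᵇ-sym : ∀ {k} (i j : Fin k) → i ≠ᵇ j ≡ j ≠ᵇ i
≠ᵇ-sym i j with i Fin.≟ j | j Fin.≟ i
... | yes _   | yes _   = refl
... | no _    | no _    = refl
... | yes i≡j | no j≢i  = contradiction (sym i≡j) j≢i
... | no i≢j  | yes j≡i = contradiction (sym j≡i) i≢j

∑-except : ∀ {k} (c : Fin k) (F : Fin k → ℚ) → ∑ (allFin k) (λ d → 𝟙 (d ≠ᵇ c) * F d) ≡ ∑ (allFin k) F + - F c
∑-except {suc k} Fin.zero F = begin
  ∑ (allFin (suc k)) (λ d → 𝟙 (d ≠ᵇ Fin.zero) * F d)            ≡⟨ ∑-allFin-suc (λ d → 𝟙 (d ≠ᵇ Fin.zero) * F d) ⟩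
  0ℚ * F Fin.zero + ∑ (allFin k) (λ d → 1ℚ * F (Fin.suc d))     ≡⟨ cong (0ℚ * F Fin.zero +_) (∑-*ˡ 1ℚ (F ∘ Fin.suc) (allFin k)) ⟩
  0ℚ * F Fin.zero + 1ℚ * ∑ (allFin k) (F ∘ Fin.suc)
    ≡⟨ solve 2 (λ x y → con 0ℚ :* x :+ con 1ℚ :* y := x :+ y :+ :- x) refl (F Fin.zero) (∑ (allFin k) (F ∘ Fin.suc)) ⟩
  F Fin.zero + ∑ (allFin k) (F ∘ Fin.suc) + - F Fin.zero        ≡⟨ cong (_+ - F Fin.zero) (∑-allFin-suc F) ⟨
  ∑ (allFin (suc k)) F + - F Fin.zero                           ∎
∑-except {suc k} (Fin.suc c) F = begin
  ∑ (allFin (suc k)) (λ d → 𝟙 (d ≠ᵇ Fin.suc c) * F d)           ≡⟨ ∑-allFin-suc (λ d → 𝟙 (d ≠ᵇ Fin.suc c) * F d) ⟩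
  1ℚ * F Fin.zero + ∑ (allFin k) (λ d → 𝟙 (d ≠ᵇ c) * F (Fin.suc d))  ≡⟨ cong (1ℚ * F Fin.zero +_) (∑-except c (F ∘ Fin.suc)) ⟩
  1ℚ * F Fin.zero + (∑ (allFin k) (F ∘ Fin.suc) + - F (Fin.suc c))
    ≡⟨ solve 3 (λ x y z → con 1ℚ :* x :+ (y :+ z) := x :+ y :+ z) refl (F Fin.zero) (∑ (allFin k) (F ∘ Fin.suc)) (- F (Fin.suc c)) ⟩
  F Fin.zero + ∑ (allFin k) (F ∘ Fin.suc) + - F (Fin.suc c)      ≡⟨ cong (_+ - F (Fin.suc c)) (∑-allFin-suc F) ⟨
  ∑ (allFin (suc k)) F + - F (Fin.suc c)                         ∎

-- Series in the finitely many variables indexed by Fin k.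
Coeff : ℕ → Set
Coeff k = Vec ℕ k → ℚ

-- Multiplication by the r-th power of one variable.
S : ∀ {k} → Fin k → ℕ → Coeff k → Coeff k
S Fin.zero    r f (a ∷ v) = shift r (λ b → f (b ∷ v)) a
S (Fin.suc i) r f (a ∷ v) = S i r (λ w → f (a ∷ w)) v

S-cong : ∀ {k} (i : Fin k) r {f g} → (∀ v → f v ≡ g v) → ∀ v → S i r f v ≡ S i r g v
S-cong Fin.zero    r e (a ∷ v) = shift-cong r a (λ b → e (b ∷ v))
S-cong (Fin.suc i) r e (a ∷ v) = S-cong i r (λ w → e (a ∷ w)) v

S-∑ : ∀ {A : Set} {k} (i : Fin k) r (f : A → Coeff k) xs v → S i r (λ w → ∑ xs (λ x → f x w)) v ≡ ∑ xs (λ x → S i r (f x) v)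
S-∑ Fin.zero    r f xs (a ∷ v) = shift-∑ r (λ x b → f x (b ∷ v)) xs a
S-∑ (Fin.suc i) r f xs (a ∷ v) = S-∑ i r (λ x w → f x (a ∷ w)) xs v

S-*ˡ : ∀ {k} (i : Fin k) r c (f : Coeff k) v → S i r (λ w → c * f w) v ≡ c * S i r f v
S-*ˡ Fin.zero    r c f (a ∷ v) = shift-*ˡ r c (λ b → f (b ∷ v)) a
S-*ˡ (Fin.suc i) r c f (a ∷ v) = S-*ˡ i r c (λ w → f (a ∷ w)) v

S-lin : ∀ {A : Set} {k} (i : Fin k) r (c : A → ℚ) (f : A → Coeff k) xs v →
        S i r (λ w → ∑ xs (λ x → c x * f x w)) v ≡ ∑ xs (λ x → c x * S i r (f x) v)
S-lin i r c f xs v = trans (S-∑ i r (λ x w → c x * f x w) xs v) (∑-cong xs (λ x → S-*ˡ i r (c x) (f x) v))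

S-0 : ∀ {k} (i : Fin k) (f : Coeff k) v → S i 0 f v ≡ f v
S-0 Fin.zero    f (a ∷ v) = refl
S-0 (Fin.suc i) f (a ∷ v) = S-0 i (λ w → f (a ∷ w)) v

S-S : ∀ {k} (i : Fin k) r s (f : Coeff k) v → S i r (S i s f) v ≡ S i (r ℕ.+ s) f v
S-S Fin.zero    r s f (a ∷ v) = shift-+ r s (λ b → f (b ∷ v)) a
S-S (Fin.suc i) r s f (a ∷ v) = S-S i r s (λ w → f (a ∷ w)) v

S-zero : ∀ {k} (i : Fin k) r v → S i r (λ _ → 0ℚ) v ≡ 0ℚ
S-zero i r v = S-∑ {ℕ} i r (λ _ _ → 0ℚ) [] v

S-comm : ∀ {k} (i j : Fin k) r s (f : Coeff k) v → S i r (S j s f) v ≡ S j s (S i r f) v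
S-comm Fin.zero    Fin.zero    r s f (a ∷ v) = shift-comm r s (λ b → f (b ∷ v)) a
S-comm Fin.zero    (Fin.suc j) r s f (a ∷ v) =
  sym (shift-apply (λ h → S j s h v) (S-zero j s v) r (λ b w → f (b ∷ w)) a)
S-comm (Fin.suc i) Fin.zero    r s f (a ∷ v) =
  shift-apply (λ h → S i r h v) (S-zero i r v) s (λ b w → f (b ∷ w)) a
S-comm (Fin.suc i) (Fin.suc j) r s f (a ∷ v) = S-comm i j r s (λ w → f (a ∷ w)) v

-- The operator `P r` in k variables, written as a sum over variables instead of by recursion, so
-- that it can be interchanged with sums over colours.
PV : ∀ {k} → ℕ → Coeff k → Coeff k
PV {k} r f v = ∑ (allFin k) (λ i → S i r f v)

PV-cong : ∀ {k} r {f g : Coeff k} → (∀ v → f v ≡ g v) → ∀ v → PV r f v ≡ PV r g v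
PV-cong {k} r e v = ∑-cong (allFin k) (λ i → S-cong i r e v)

PV-toList : ∀ {k} r f (v : Vec ℕ k) → PV r (f ∘ toList) v ≡ P r f (toList v)
PV-toList r f []      = refl
PV-toList r f (a ∷ v) = trans (∑-allFin-suc (λ i → S i r (f ∘ toList) (a ∷ v)))
  (cong (shift r (λ b → f (b ∷ toList v)) a +_) (PV-toList r (f ∂ a) v))

∑-S : ∀ {k} (i : Fin k) r s (f : Coeff k) v → ∑ (allFin k) (λ d → S i r (S d s f) v) ≡ S i r (PV s f) v
∑-S {k} i r s f v = sym (S-∑ i r (λ d → S d s f) (allFin k) v)

PV-S : ∀ {k} (i : Fin k) r s (f : Coeff k) v → PV r (S i s f) v ≡ S i s (PV r f) v
PV-S {k} i r s f v = trans (∑-cong (allFin k) (λ d → S-comm d i r s f v)) (∑-S i s r f v)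

one : ∀ {k} → Coeff k
one = oneS ∘ toList

ones : ∀ {k} → ℕ → Coeff k
ones zero    = one
ones (suc l) = PV 1 (ones l)

ones≡PP : ∀ {k} l (v : Vec ℕ k) → ones l v ≡ PP (replicate l 1) (toList v)
ones≡PP zero    v = refl
ones≡PP (suc l) v = trans (PV-cong 1 (ones≡PP l) v) (PV-toList 1 (PP (replicate l 1)) v)

-- The partition (r+1, 1, ..., 1) with l trailing ones. In a star, r counts the factors x_c
-- contributed by the leaves; the extra 1 is the centre's own factor x_c.
hook : ℕ → ℕ → List ℕ
hook r l = suc r ∷ replicate l 1

PV-ones : ∀ {k} r l (v : Vec ℕ k) → PV (suc r) (ones l) v ≡ PP (hook r l) (toList v)
PV-ones r l v = trans (PV-cong (suc r) (ones≡PP l) v) (PV-toList (suc r) (PP (replicate l 1)) v)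

-- The monomial of the colouring κ as a coefficient function, built by multiplying 1 by one variable
-- per vertex.
mono : ∀ {m k} → Vec (Fin k) m → Coeff k
mono []      = one
mono (c ∷ κ) = S c 1 (mono κ)

matches : ∀ {k} → (Fin k → ℕ) → Coeff k
matches h []      = 1ℚ
matches h (a ∷ v) = 𝟙 (does (h Fin.zero ℕ.≟ a)) * matches (h ∘ Fin.suc) v

𝟙-≡-dec : ∀ {k} (h : Fin k → ℕ) v → 𝟙 (does (≡-dec ℕ._≟_ (tabulate h) (toList v))) ≡ matches h v
𝟙-≡-dec h []      = refl
𝟙-≡-dec h (a ∷ v) = trans (𝟙-∧ (does (h Fin.zero ℕ.≟ a)) _) (cong (𝟙 (does (h Fin.zero ℕ.≟ a)) *_) (𝟙-≡-dec (h ∘ Fin.suc) v))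

matches-0 : ∀ {k} (v : Vec ℕ k) → matches (λ _ → 0) v ≡ one v
matches-0 []          = refl
matches-0 (zero ∷ v)  = trans (ℚ.*-identityˡ (matches (λ _ → 0) v)) (matches-0 v)
matches-0 (suc a ∷ v) = ℚ.*-zeroˡ (matches (λ _ → 0) v)

bump : ∀ {k} → Fin k → (Fin k → ℕ) → Fin k → ℕ
bump c h i = if does (c Fin.≟ i) then suc (h i) else h i

matches-bump : ∀ {k} (c : Fin k) h v → matches (bump c h) v ≡ S c 1 (matches h) v
matches-bump Fin.zero    h (zero ∷ v)  = ℚ.*-zeroˡ (matches (h ∘ Fin.suc) v)
matches-bump Fin.zero    h (suc a ∷ v) = refl
matches-bump (Fin.suc c) h (a ∷ v)     =
  trans (cong (𝟙 (does (h Fin.zero ℕ.≟ a)) *_) (matches-bump c (h ∘ Fin.suc) v))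
        (sym (S-*ˡ c 1 (𝟙 (does (h Fin.zero ℕ.≟ a))) (matches (h ∘ Fin.suc)) v))

matches-colourCount : ∀ {m k} (κ : Vec (Fin k) m) v → matches (colourCount κ) v ≡ mono κ v
matches-colourCount []      v = matches-0 v
matches-colourCount (c ∷ κ) v = trans (matches-bump c (colourCount κ) v) (S-cong c 1 (matches-colourCount κ) v)

𝟙-hasType? : ∀ {m} α (κ : Vec (Fin (length α)) m) → 𝟙 (hasType? α κ) ≡ mono κ (fromList α)
𝟙-hasType? α κ = begin
  𝟙 (does (≡-dec ℕ._≟_ (map (colourCount κ) (allFin (length α))) α))
    ≡⟨ cong₂ (λ xs ys → 𝟙 (does (≡-dec ℕ._≟_ xs ys))) (map-tabulate id (colourCount κ)) (sym (toList∘fromList α)) ⟩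
  𝟙 (does (≡-dec ℕ._≟_ (tabulate (colourCount κ)) (toList (fromList α))))
    ≡⟨ 𝟙-≡-dec (colourCount κ) (fromList α) ⟩
  matches (colourCount κ) (fromList α)
    ≡⟨ matches-colourCount κ (fromList α) ⟩
  mono κ (fromList α) ∎

chromatic : ∀ {m} → Graph m → ∀ {k} → Coeff k
chromatic {m} G {k} v = ∑ (allMaps m k) (λ κ → 𝟙 (proper? G κ) * mono κ v)

X≡chromatic : ∀ {m} (G : Graph m) α → X G α ≡ chromatic G (fromList α)
X≡chromatic {m} G α = trans (ℕtoℚ-length-filterᵇ _ (allMaps m (length α)))
  (∑-cong (allMaps m (length α)) (λ κ → trans (𝟙-∧ (proper? G κ) (hasType? α κ)) (cong (𝟙 (proper? G κ) *_) (𝟙-hasType? α κ))))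

∑-allMaps : ∀ {k} m (f : Vec (Fin k) (suc m) → ℚ) →
            ∑ (allMaps (suc m) k) f ≡ ∑ (allFin k) (λ c → ∑ (allMaps m k) (λ κ → f (c ∷ κ)))
∑-allMaps {k} m f = trans (∑-concatMap (λ c → map (c ∷_) (allMaps m k)) f (allFin k))
  (∑-cong (allFin k) (λ c → ∑-map (c ∷_) f (allMaps m k)))

allᵇ-cong : ∀ {A : Set} {b b′ : A → Bool} → (∀ x → b x ≡ b′ x) → ∀ xs → allᵇ b xs ≡ allᵇ b′ xs
allᵇ-cong e []       = refl
allᵇ-cong e (x ∷ xs) = cong₂ _∧_ (e x) (allᵇ-cong e xs)

allᵇ-true : ∀ {A : Set} (xs : List A) → allᵇ (λ _ → true) xs ≡ true
allᵇ-true []       = refl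
allᵇ-true (x ∷ xs) = allᵇ-true xs

allᵇ-tabulate : ∀ {A : Set} {n} (h : Fin n → A) b → allᵇ b (tabulate h) ≡ allᵇ (b ∘ h) (allFin n)
allᵇ-tabulate {n = zero}  h b = refl
allᵇ-tabulate {n = suc n} h b = cong (b (h Fin.zero) ∧_)
  (trans (allᵇ-tabulate (h ∘ Fin.suc) b) (sym (allᵇ-tabulate Fin.suc (b ∘ h))))

-- Proper colourings of a star

avoids : ∀ {m k} → Fin k → Vec (Fin k) m → Bool
avoids c []      = true
avoids c (d ∷ w) = d ≠ᵇ c ∧ avoids c w

allᵇ-avoids : ∀ {m k} (c : Fin k) (w : Vec (Fin k) m) → allᵇ (λ i → lookup w i ≠ᵇ c) (allFin m) ≡ avoids c w
allᵇ-avoids c []      = refl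
allᵇ-avoids c (d ∷ w) = cong (d ≠ᵇ c ∧_) (trans (allᵇ-tabulate Fin.suc (λ i → lookup (d ∷ w) i ≠ᵇ c)) (allᵇ-avoids c w))

-- `proper?` inspects ordered pairs, so each edge is tested once from the centre and once from the
-- leaf; idempotence of conjunction merges the two tests.
proper?-star : ∀ {m k} (c : Fin k) (w : Vec (Fin k) m) → proper? (star (suc m)) (c ∷ w) ≡ avoids c w
proper?-star {m} c w = trans
  (cong₂ _∧_
    (trans (allᵇ-tabulate Fin.suc (ok Fin.zero)) (trans (allᵇ-cong (λ i → ≠ᵇ-sym c (lookup w i)) (allFin m)) (allᵇ-avoids c w)))
    (trans (allᵇ-tabulate Fin.suc (λ u → allᵇ (ok u) (allFin (suc m)))) (trans (allᵇ-cong (λ i →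
        trans (cong (lookup w i ≠ᵇ c ∧_) (trans (allᵇ-tabulate Fin.suc (ok (Fin.suc i))) (allᵇ-true (allFin m)))) (∧-identityʳ _))
      (allFin m)) (allᵇ-avoids c w))))
  (∧-idem (avoids c w))
  where
  ok : Fin (suc m) → Fin (suc m) → Bool
  ok u v = not (starAdj u v) ∨ not (does (lookup (c ∷ w) u Fin.≟ lookup (c ∷ w) v))

-- This is (p₁ - x_c)^m: the m leaves independently take any colour other than c.
leaves : ∀ {k} → ℕ → Fin k → Coeff k
leaves {k} m c v = ∑ (allMaps m k) (λ w → 𝟙 (avoids c w) * mono w v)

leaves-suc : ∀ {k} m (c : Fin k) v → leaves (suc m) c v ≡ PV 1 (leaves m c) v + - S c 1 (leaves m c) v
leaves-suc {k} m c v = begin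
  leaves (suc m) c v
    ≡⟨ ∑-allMaps m (λ w → 𝟙 (avoids c w) * mono w v) ⟩
  ∑ (allFin k) (λ d → ∑ (allMaps m k) (λ w → 𝟙 (d ≠ᵇ c ∧ avoids c w) * S d 1 (mono w) v))
    ≡⟨ ∑-cong (allFin k) (λ d → trans
         (∑-cong (allMaps m k) (λ w → trans (cong (_* S d 1 (mono w) v) (𝟙-∧ (d ≠ᵇ c) (avoids c w)))
                                            (ℚ.*-assoc (𝟙 (d ≠ᵇ c)) (𝟙 (avoids c w)) (S d 1 (mono w) v))))
         (trans (∑-*ˡ (𝟙 (d ≠ᵇ c)) (λ w → 𝟙 (avoids c w) * S d 1 (mono w) v) (allMaps m k))
                (cong (𝟙 (d ≠ᵇ c) *_) (sym (S-lin d 1 (𝟙 ∘ avoids c) mono (allMaps m k) v))))) ⟩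
  ∑ (allFin k) (λ d → 𝟙 (d ≠ᵇ c) * S d 1 (leaves m c) v)
    ≡⟨ ∑-except c (λ d → S d 1 (leaves m c) v) ⟩
  PV 1 (leaves m c) v + - S c 1 (leaves m c) v ∎

-- A term (q , r , l) stands for q · p_{r+1} p₁ˡ.
HookTerm : Set
HookTerm = ℚ × ℕ × ℕ

combine : List HookTerm → (ℕ → ℕ → ℚ) → ℚ
combine hs T = ∑ hs (λ h → proj₁ h * T (proj₁ (proj₂ h)) (proj₂ (proj₂ h)))

addLeaf attachLeaf : HookTerm → HookTerm
addLeaf    (q , r , l) = q , r , suc l
attachLeaf (q , r , l) = - q , suc r , l

sgn : ℕ → ℚ
sgn zero    = 1ℚ
sgn (suc m) = - sgn m

-- Multiplication by p₁ - x, without collecting like terms. The leading ±xᵐ yields the new leading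
-- term through -x and the entry with l = 1 through p₁; every older tail term goes both ways. Hence
-- each tail term keeps at least one factor p₁.
starTail : ℕ → List HookTerm
starTail zero    = []
starTail (suc m) = (sgn m , m , 1) ∷ map addLeaf (starTail m) ++ map attachLeaf (starTail m)

-- The expansion of (p₁ - x)ᵐ in powers xʳ p₁ˡ, with the term ±xᵐ first.
starHooks : ℕ → List HookTerm
starHooks m = (sgn m , m , 0) ∷ starTail m

combine-suc : ∀ m T → combine (starHooks (suc m)) T ≡
              combine (starHooks m) (λ r l → T r (suc l)) + - combine (starHooks m) (λ r l → T (suc r) l)
combine-suc m T = begin
  - sgn m * T (suc m) 0 + (sgn m * T m 1 + ∑ (map addLeaf (starTail m) ++ map attachLeaf (starTail m)) t)
    ≡⟨ cong (λ z → - sgn m * T (suc m) 0 + (sgn m * T m 1 + z))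
         (trans (∑-++ t (map addLeaf (starTail m)) (map attachLeaf (starTail m)))
           (cong₂ _+_ (∑-map addLeaf t (starTail m))
             (trans (∑-map attachLeaf t (starTail m))
               (trans (∑-cong (starTail m) (λ h → solve 2 (λ q x → :- q :* x := con (- 1ℚ) :* (q :* x)) refl (proj₁ h) (T (suc (proj₁ (proj₂ h))) (proj₂ (proj₂ h)))))
                      (∑-*ˡ (- 1ℚ) (λ h → proj₁ h * T (suc (proj₁ (proj₂ h))) (proj₂ (proj₂ h))) (starTail m)))))) ⟩
  - sgn m * T (suc m) 0 + (sgn m * T m 1 + (A + - 1ℚ * B))
    ≡⟨ solve 5 (λ s x y a b → :- s :* x :+ (s :* y :+ (a :+ con (- 1ℚ) :* b)) := s :* y :+ a :+ :- (s :* x :+ b)) refl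
         (sgn m) (T (suc m) 0) (T m 1) A B ⟩
  sgn m * T m 1 + A + - (sgn m * T (suc m) 0 + B) ∎
  where
  t = λ (h : HookTerm) → proj₁ h * T (proj₁ (proj₂ h)) (proj₂ (proj₂ h))
  A = combine (starTail m) (λ r l → T r (suc l))
  B = combine (starTail m) (λ r l → T (suc r) l)

PV-lin : ∀ {A : Set} {k} r (c : A → ℚ) (f : A → Coeff k) xs v →
         PV r (λ w → ∑ xs (λ x → c x * f x w)) v ≡ ∑ xs (λ x → c x * PV r (f x) v)
PV-lin {k = k} r c f xs v = trans (∑-cong (allFin k) (λ i → S-lin i r c f xs v))
  (trans (∑-swap (λ i x → c x * S i r (f x) v) (allFin k) xs) (∑-cong xs (λ x → ∑-*ˡ (c x) (λ i → S i r (f x) v) (allFin k))))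

leaves-expansion : ∀ {k} m (c : Fin k) v → leaves m c v ≡ combine (starHooks m) (λ r l → S c r (ones l) v)
leaves-expansion zero    c v = cong (λ z → 1ℚ * z + 0ℚ) (sym (S-0 c one v))
leaves-expansion (suc m) c v = begin
  leaves (suc m) c v                               ≡⟨ leaves-suc m c v ⟩
  PV 1 (leaves m c) v + - S c 1 (leaves m c) v
    ≡⟨ cong₂ (λ x y → x + - y)
         (trans (PV-cong 1 (leaves-expansion m c) v)
           (trans (PV-lin 1 proj₁ (λ h → S c (proj₁ (proj₂ h)) (ones (proj₂ (proj₂ h)))) (starHooks m) v)
                  (∑-cong (starHooks m) (λ h → cong (proj₁ h *_) (PV-S c 1 (proj₁ (proj₂ h)) (ones (proj₂ (proj₂ h))) v)))))
         (trans (S-cong c 1 (leaves-expansion m c) v)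
           (trans (S-lin c 1 proj₁ (λ h → S c (proj₁ (proj₂ h)) (ones (proj₂ (proj₂ h)))) (starHooks m) v)
                  (∑-cong (starHooks m) (λ h → cong (proj₁ h *_) (S-S c 1 (proj₁ (proj₂ h)) (ones (proj₂ (proj₂ h))) v))))) ⟩
  combine (starHooks m) (λ r l → S c r (ones (suc l)) v) + - combine (starHooks m) (λ r l → S c (suc r) (ones l) v)
    ≡⟨ combine-suc m (λ r l → S c r (ones l) v) ⟨
  combine (starHooks (suc m)) (λ r l → S c r (ones l) v) ∎

combine-PP : ∀ {k} hs (v : Vec ℕ k) → combine hs (λ r l → PV (suc r) (ones l) v) ≡ combine hs (λ r l → PP (hook r l) (toList v))
combine-PP hs v = ∑-cong hs (λ h → cong (proj₁ h *_) (PV-ones (proj₁ (proj₂ h)) (proj₂ (proj₂ h)) v))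

-- With the colour c of the centre fixed, a term xʳ p₁ˡ of the leaf expansion gains one more factor
-- x_c; summing over c turns x_c^(r+1) into p_{r+1}.
X-star : ∀ m α → X (star (suc m)) α ≡ combine (starHooks m) (λ r l → PP (hook r l) α)
X-star m α = begin
  X (star (suc m)) α             ≡⟨ X≡chromatic (star (suc m)) α ⟩
  chromatic (star (suc m)) v     ≡⟨ ∑-allMaps m (λ κ → 𝟙 (proper? (star (suc m)) κ) * mono κ v) ⟩
  ∑ (allFin k) (λ c → ∑ (allMaps m k) (λ w → 𝟙 (proper? (star (suc m)) (c ∷ w)) * S c 1 (mono w) v))
    ≡⟨ ∑-cong (allFin k) (λ c → trans
         (∑-cong (allMaps m k) (λ w → cong (λ b → 𝟙 b * S c 1 (mono w) v) (proper?-star c w)))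
         (trans (sym (S-lin c 1 (𝟙 ∘ avoids c) mono (allMaps m k) v))
         (trans (S-cong c 1 (leaves-expansion m c) v)
         (trans (S-lin c 1 proj₁ (λ h → S c (proj₁ (proj₂ h)) (ones (proj₂ (proj₂ h)))) (starHooks m) v)
                (∑-cong (starHooks m) (λ h → cong (proj₁ h *_) (S-S c 1 (proj₁ (proj₂ h)) (ones (proj₂ (proj₂ h))) v))))))) ⟩
  ∑ (allFin k) (λ c → combine (starHooks m) (λ r l → S c (suc r) (ones l) v))
    ≡⟨ ∑-swap (λ c h → proj₁ h * S c (suc (proj₁ (proj₂ h))) (ones (proj₂ (proj₂ h))) v) (allFin k) (starHooks m) ⟩
  ∑ (starHooks m) (λ h → ∑ (allFin k) (λ c → proj₁ h * S c (suc (proj₁ (proj₂ h))) (ones (proj₂ (proj₂ h))) v))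
    ≡⟨ ∑-cong (starHooks m) (λ h → ∑-*ˡ (proj₁ h) (λ c → S c (suc (proj₁ (proj₂ h))) (ones (proj₂ (proj₂ h))) v) (allFin k)) ⟩
  combine (starHooks m) (λ r l → PV (suc r) (ones l) v)
    ≡⟨ combine-PP (starHooks m) v ⟩
  combine (starHooks m) (λ r l → PP (hook r l) (toList v))
    ≡⟨ cong (λ β → combine (starHooks m) (λ r l → PP (hook r l) β)) (toList∘fromList α) ⟩
  combine (starHooks m) (λ r l → PP (hook r l) α) ∎
  where
  k = length α
  v = fromList α

-- Proper colourings of the triangle

proper?-C3 : ∀ {k} (a b d : Fin k) → proper? C3 (a ∷ b ∷ d ∷ []) ≡ b ≠ᵇ a ∧ (d ≠ᵇ a ∧ d ≠ᵇ b)
proper?-C3 a b d rewrite ≠ᵇ-sym a b | ≠ᵇ-sym a d | ≠ᵇ-sym b d with b ≠ᵇ a | d ≠ᵇ a | d ≠ᵇ b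
... | false | _     | _     = refl
... | true  | false | _     = refl
... | true  | true  | false = refl
... | true  | true  | true  = refl

𝟙-idem : ∀ b → 𝟙 b * 𝟙 b ≡ 𝟙 b
𝟙-idem b = trans (sym (𝟙-∧ b b)) (cong 𝟙 (∧-idem b))

-- Inclusion-exclusion for a third vertex avoiding the colours of two adjacent ones. The factor
-- `𝟙 (b ≠ᵇ a)` excludes the case in which the same colour would be subtracted twice.
∑-except₂ : ∀ {k} (a b : Fin k) F →
  ∑ (allFin k) (λ d → 𝟙 (b ≠ᵇ a ∧ (d ≠ᵇ a ∧ d ≠ᵇ b)) * F d) ≡ 𝟙 (b ≠ᵇ a) * (∑ (allFin k) F + - F a + - F b)
∑-except₂ {k} a b F = begin
  ∑ (allFin k) (λ d → 𝟙 (b ≠ᵇ a ∧ (d ≠ᵇ a ∧ d ≠ᵇ b)) * F d)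
    ≡⟨ ∑-cong (allFin k) (λ d → trans (cong (_* F d) (trans (𝟙-∧ (b ≠ᵇ a) _) (cong (𝟙 (b ≠ᵇ a) *_) (𝟙-∧ (d ≠ᵇ a) (d ≠ᵇ b)))))
         (solve 4 (λ x y z f → x :* (y :* z) :* f := x :* (y :* (z :* f))) refl (𝟙 (b ≠ᵇ a)) (𝟙 (d ≠ᵇ a)) (𝟙 (d ≠ᵇ b)) (F d))) ⟩
  ∑ (allFin k) (λ d → 𝟙 (b ≠ᵇ a) * (𝟙 (d ≠ᵇ a) * (𝟙 (d ≠ᵇ b) * F d)))
    ≡⟨ ∑-*ˡ (𝟙 (b ≠ᵇ a)) (λ d → 𝟙 (d ≠ᵇ a) * (𝟙 (d ≠ᵇ b) * F d)) (allFin k) ⟩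
  𝟙 (b ≠ᵇ a) * ∑ (allFin k) (λ d → 𝟙 (d ≠ᵇ a) * (𝟙 (d ≠ᵇ b) * F d))
    ≡⟨ cong (𝟙 (b ≠ᵇ a) *_) (trans (∑-except a (λ d → 𝟙 (d ≠ᵇ b) * F d))
         (cong₂ (λ x y → x + - (𝟙 y * F a)) (∑-except b F) (≠ᵇ-sym a b))) ⟩
  𝟙 (b ≠ᵇ a) * (∑ (allFin k) F + - F b + - (𝟙 (b ≠ᵇ a) * F a))
    ≡⟨ solve 4 (λ x s f g → x :* (s :+ :- g :+ :- (x :* f)) := x :* (s :+ :- g) :+ :- (x :* x :* f)) refl
         (𝟙 (b ≠ᵇ a)) (∑ (allFin k) F) (F a) (F b) ⟩
  𝟙 (b ≠ᵇ a) * (∑ (allFin k) F + - F b) + - (𝟙 (b ≠ᵇ a) * 𝟙 (b ≠ᵇ a) * F a)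
    ≡⟨ cong (λ x → 𝟙 (b ≠ᵇ a) * (∑ (allFin k) F + - F b) + - (x * F a)) (𝟙-idem (b ≠ᵇ a)) ⟩
  𝟙 (b ≠ᵇ a) * (∑ (allFin k) F + - F b) + - (𝟙 (b ≠ᵇ a) * F a)
    ≡⟨ solve 4 (λ x s f g → x :* (s :+ :- g) :+ :- (x :* f) := x :* (s :+ :- f :+ :- g)) refl
         (𝟙 (b ≠ᵇ a)) (∑ (allFin k) F) (F a) (F b) ⟩
  𝟙 (b ≠ᵇ a) * (∑ (allFin k) F + - F a + - F b) ∎

C3Tail : List HookTerm
C3Tail = (1ℚ , 0 , 2) ∷ (- (1ℚ + 1ℚ + 1ℚ) , 1 , 1) ∷ []

C3Hooks : List HookTerm
C3Hooks = (1ℚ + 1ℚ , 2 , 0) ∷ C3Tail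

∑-linear₄ : ∀ {A : Set} p q r s (e f g h : A → ℚ) xs →
  ∑ xs (λ x → p * e x + (q * f x + (r * g x + s * h x))) ≡ p * ∑ xs e + (q * ∑ xs f + (r * ∑ xs g + s * ∑ xs h))
∑-linear₄ p q r s e f g h xs =
  trans (∑-+ (λ x → p * e x) (λ x → q * f x + (r * g x + s * h x)) xs) (cong₂ _+_ (∑-*ˡ p e xs)
  (trans (∑-+ (λ x → q * f x) (λ x → r * g x + s * h x) xs) (cong₂ _+_ (∑-*ˡ q f xs)
  (trans (∑-+ (λ x → r * g x) (λ x → s * h x) xs) (cong₂ _+_ (∑-*ˡ r g xs) (∑-*ˡ s h xs))))))

-- The vertices are summed out from the last to the first. The third turns x_a x_b into x_a x_b (p₁
-- - x_a - x_b), which is `G a b`; the second, avoiding a, leaves x_a p₁² - 2 x_a² p₁ - x_a p₂ + 2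
-- x_a³, and the sum over a finishes.
X-C3 : ∀ α → X C3 α ≡ combine C3Hooks (λ r l → PP (hook r l) α)
X-C3 α = begin
  X C3 α           ≡⟨ X≡chromatic C3 α ⟩
  chromatic C3 v
    ≡⟨ trans (∑-allMaps 2 term) (∑-cong (allFin k) (λ a → trans (∑-allMaps 1 (λ κ → term (a ∷ κ)))
         (∑-cong (allFin k) (λ b → trans (∑-allMaps 0 (λ κ → term (a ∷ b ∷ κ)))
           (∑-cong (allFin k) (λ d → trans (ℚ.+-identityʳ (term (a ∷ b ∷ d ∷ [])))
                                           (cong (λ t → 𝟙 t * F a b d) (proper?-C3 a b d)))))))) ⟩
  ∑ (allFin k) (λ a → ∑ (allFin k) (λ b → ∑ (allFin k) (λ d → 𝟙 (b ≠ᵇ a ∧ (d ≠ᵇ a ∧ d ≠ᵇ b)) * F a b d)))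
    ≡⟨ ∑-cong (allFin k) (λ a → trans (∑-cong (allFin k) (λ b → ∑-except₂ a b (F a b))) (trans (∑-except a (G a)) (inner a))) ⟩
  ∑ (allFin k) (λ a → 1ℚ * S a 1 (ones 2) v + (- (1ℚ + 1ℚ) * S a 2 (ones 1) v + (- 1ℚ * S a 1 (PV 2 one) v + (1ℚ + 1ℚ) * S a 3 one v)))
    ≡⟨ ∑-linear₄ 1ℚ (- (1ℚ + 1ℚ)) (- 1ℚ) (1ℚ + 1ℚ) (λ a → S a 1 (ones 2) v) (λ a → S a 2 (ones 1) v)
                 (λ a → S a 1 (PV 2 one) v) (λ a → S a 3 one v) (allFin k) ⟩
  1ℚ * PV 1 (ones 2) v + (- (1ℚ + 1ℚ) * PV 2 (ones 1) v + (- 1ℚ * PV 1 (PV 2 one) v + (1ℚ + 1ℚ) * PV 3 one v))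
    ≡⟨ cong (λ x → 1ℚ * PV 1 (ones 2) v + (- (1ℚ + 1ℚ) * PV 2 (ones 1) v + (- 1ℚ * x + (1ℚ + 1ℚ) * PV 3 one v))) PV-comm ⟩
  1ℚ * PV 1 (ones 2) v + (- (1ℚ + 1ℚ) * PV 2 (ones 1) v + (- 1ℚ * PV 2 (ones 1) v + (1ℚ + 1ℚ) * PV 3 one v))
    ≡⟨ solve 3 (λ x y z → con 1ℚ :* x :+ (:- (con 1ℚ :+ con 1ℚ) :* y :+ (:- con 1ℚ :* y :+ (con 1ℚ :+ con 1ℚ) :* z))
                 := (con 1ℚ :+ con 1ℚ) :* z :+ (con 1ℚ :* x :+ (:- (con 1ℚ :+ con 1ℚ :+ con 1ℚ) :* y :+ con 0ℚ))) refl
         (PV 1 (ones 2) v) (PV 2 (ones 1) v) (PV 3 one v) ⟩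
  combine C3Hooks (λ r l → PV (suc r) (ones l) v)      ≡⟨ combine-PP C3Hooks v ⟩
  combine C3Hooks (λ r l → PP (hook r l) (toList v))
    ≡⟨ cong (λ β → combine C3Hooks (λ r l → PP (hook r l) β)) (toList∘fromList α) ⟩
  combine C3Hooks (λ r l → PP (hook r l) α)            ∎
  where
  k = length α
  v = fromList α
  term : Vec (Fin k) 3 → ℚ
  term κ = 𝟙 (proper? C3 κ) * mono κ v
  F : Fin k → Fin k → Fin k → ℚ
  F a b d = S a 1 (S b 1 (S d 1 one)) v
  G : Fin k → Fin k → ℚ
  G a b = ∑ (allFin k) (F a b) + - F a b a + - F a b b
  PV-comm : PV 1 (PV 2 one) v ≡ PV 2 (ones 1) v
  PV-comm = trans (∑-cong (allFin k) (λ i → sym (∑-S i 1 2 one v))) (trans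
    (∑-swap (λ i d → S i 1 (S d 2 one) v) (allFin k) (allFin k))
    (∑-cong (allFin k) (λ d → PV-S d 1 2 one v)))
  F₃ : ∀ a → F a a a ≡ S a 3 one v
  F₃ a = trans (S-cong a 1 (S-S a 1 1 one) v) (S-S a 1 2 one v)
  ∑F : ∀ a b → ∑ (allFin k) (F a b) ≡ S a 1 (S b 1 (ones 1)) v
  ∑F a b = trans (sym (S-∑ a 1 (λ d → S b 1 (S d 1 one)) (allFin k) v)) (S-cong a 1 (∑-S b 1 1 one) v)
  ∑G : ∀ a → ∑ (allFin k) (G a) ≡ S a 1 (ones 2) v + - S a 2 (ones 1) v + - S a 1 (PV 2 one) v
  ∑G a = begin
    ∑ (allFin k) (λ b → ∑ (allFin k) (F a b) + - F a b a + - F a b b)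
      ≡⟨ ∑-+ (λ b → ∑ (allFin k) (F a b) + - F a b a) (λ b → - F a b b) (allFin k) ⟩
    ∑ (allFin k) (λ b → ∑ (allFin k) (F a b) + - F a b a) + ∑ (allFin k) (λ b → - F a b b)
      ≡⟨ cong₂ _+_ (trans (∑-+ (λ b → ∑ (allFin k) (F a b)) (λ b → - F a b a) (allFin k))
                          (cong₂ _+_ (trans (∑-cong (allFin k) (∑F a)) (∑-S a 1 1 (ones 1) v)) (∑-neg (λ b → F a b a))))
                   (∑-neg (λ b → F a b b)) ⟩
    S a 1 (ones 2) v + - ∑ (allFin k) (λ b → F a b a) + - ∑ (allFin k) (λ b → F a b b)
      ≡⟨ cong₂ (λ x y → S a 1 (ones 2) v + - x + - y)
           (trans (sym (S-∑ a 1 (λ b → S b 1 (S a 1 one)) (allFin k) v))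
             (trans (S-cong a 1 (PV-S a 1 1 one) v) (S-S a 1 1 (ones 1) v)))
           (trans (∑-cong (allFin k) (λ b → S-cong a 1 (S-S b 1 1 one) v)) (∑-S a 1 2 one v)) ⟩
    S a 1 (ones 2) v + - S a 2 (ones 1) v + - S a 1 (PV 2 one) v ∎
    where
    ∑-neg : ∀ (f : Fin k → ℚ) → ∑ (allFin k) (λ b → - f b) ≡ - ∑ (allFin k) f
    ∑-neg f = trans (∑-cong (allFin k) (λ b → solve 1 (λ x → :- x := con (- 1ℚ) :* x) refl (f b)))
      (trans (∑-*ˡ (- 1ℚ) f (allFin k)) (solve 1 (λ x → con (- 1ℚ) :* x := :- x) refl (∑ (allFin k) f)))
  inner : ∀ a → ∑ (allFin k) (G a) + - G a a ≡
    1ℚ * S a 1 (ones 2) v + (- (1ℚ + 1ℚ) * S a 2 (ones 1) v + (- 1ℚ * S a 1 (PV 2 one) v + (1ℚ + 1ℚ) * S a 3 one v))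
  inner a = trans (cong₂ (λ x y → x + - y) (∑G a)
      (cong₂ (λ x y → x + - y + - y) (trans (∑F a a) (S-S a 1 1 (ones 1) v)) (F₃ a)))
    (solve 4 (λ x y z w → x :+ :- y :+ :- z :+ :- (y :+ :- w :+ :- w)
       := con 1ℚ :* x :+ (:- (con 1ℚ :+ con 1ℚ) :* y :+ (:- con 1ℚ :* z :+ (con 1ℚ :+ con 1ℚ) :* w))) refl
       (S a 1 (ones 2) v) (S a 2 (ones 1) v) (S a 1 (PV 2 one) v) (S a 3 one v))

-- ω and the series Y

scale : ℚ → Poly → Poly
scale q = map (λ cl → q * proj₁ cl , proj₂ cl)

pairing-scale : ∀ q cs φ → pairing (scale q cs) φ ≡ q * pairing cs φ
pairing-scale q cs φ = trans (∑-map _ _ cs)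
  (trans (∑-cong cs (λ cl → ℚ.*-assoc q (proj₁ cl) (φ (proj₂ cl)))) (∑-*ˡ q _ cs))

twist : Poly → Poly
twist = map (λ cl → ε (proj₂ cl) * proj₁ cl , proj₂ cl)

pairing-twist : ∀ cs φ → pairing (twist cs) φ ≡ pairing cs (λ μ → ε μ * φ μ)
pairing-twist cs φ = trans (∑-map _ _ cs) (∑-cong cs (λ cl →
  solve 3 (λ e c x → e :* c :* x := c :* (e :* x)) refl (ε (proj₂ cl)) (proj₁ cl) (φ (proj₂ cl))))

ε-↭ : ∀ {μ ν} → μ ↭ ν → ε μ ≡ ε ν
ε-↭ ↭.refl          = refl
ε-↭ (↭.prep r e)    = cong (λ x → if isEven r then - x else x) (ε-↭ e)
ε-↭ (↭.trans e e′)  = trans (ε-↭ e) (ε-↭ e′)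
ε-↭ (↭.swap r s e) rewrite ε-↭ e with isEven r | isEven s
... | true  | true  = refl
... | true  | false = refl
... | false | true  = refl
... | false | false = refl

twist-positive : ∀ {cs} → All (Positive ∘ proj₂) cs → All (Positive ∘ proj₂) (twist cs)
twist-positive = All.map⁺

-- ω is well defined: the difference of the two expansions is a relation among power sum products,
-- and μ ↦ `ε μ * PP μ α` is invariant under reordering the parts, so it annihilates that relation.
pairing≡⇒pairing-ε≡ : ∀ {cs ds} → All (Positive ∘ proj₂) cs → All (Positive ∘ proj₂) ds →
  (∀ α → pairing cs (λ μ → PP μ α) ≡ pairing ds (λ μ → PP μ α)) →
  ∀ α → pairing cs (λ μ → ε μ * PP μ α) ≡ pairing ds (λ μ → ε μ * PP μ α)
pairing≡⇒pairing-ε≡ {cs} {ds} pos-cs pos-ds e α = begin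
  pairing cs φ                                   ≡⟨ solve 2 (λ x y → x := x :+ con (- 1ℚ) :* y :+ y) refl (pairing cs φ) (pairing ds φ) ⟩
  pairing cs φ + - 1ℚ * pairing ds φ + pairing ds φ
    ≡⟨ cong (_+ pairing ds φ) (trans (sym (difference φ)) (pProd-independent pos rel φ inv)) ⟩
  0ℚ + pairing ds φ                              ≡⟨ ℚ.+-identityˡ (pairing ds φ) ⟩
  pairing ds φ                                   ∎
  where
  φ : List ℕ → ℚ
  φ μ = ε μ * PP μ α
  difference : ∀ φ → pairing (cs ++ scale (- 1ℚ) ds) φ ≡ pairing cs φ + - 1ℚ * pairing ds φ
  difference φ = trans (∑-++ _ cs (scale (- 1ℚ) ds)) (cong (pairing cs φ +_) (pairing-scale (- 1ℚ) ds φ))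
  pos : All (Positive ∘ proj₂) (cs ++ scale (- 1ℚ) ds)
  pos = All.++⁺ pos-cs (All.map⁺ pos-ds)
  rel : ∀ β → pairing (cs ++ scale (- 1ℚ) ds) (λ μ → PP μ β) ≡ 0ℚ
  rel β = trans (difference (λ μ → PP μ β)) (trans (cong (_+ - 1ℚ * pairing ds (λ μ → PP μ β)) (e β))
    (solve 1 (λ x → x :+ con (- 1ℚ) :* x := con 0ℚ) refl (pairing ds (λ μ → PP μ β))))
  inv : ∀ μ → φ (sort μ) ≡ φ μ
  inv μ = cong₂ _*_ (ε-↭ (sort-↭ μ)) (PP-↭ (sort-↭ μ) α)

IsOmega⇒ : ∀ {f g ds} → All (Positive ∘ proj₂) ds → (∀ α → f α ≡ pairing ds (λ μ → PP μ α)) → IsOmega f g →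
           ∀ α → g α ≡ pairing ds (λ μ → ε μ * PP μ α)
IsOmega⇒ {f} {g} {ds} pos e (cs , pos-cs , f≈ , g≈) α = begin
  g α                                 ≡⟨ g≈ α ⟩
  lin (twist cs) pProd α              ≡⟨ lin≡pairingPP (twist-positive pos-cs) α ⟩
  pairing (twist cs) (λ μ → PP μ α)   ≡⟨ pairing-twist cs (λ μ → PP μ α) ⟩
  pairing cs (λ μ → ε μ * PP μ α)
    ≡⟨ pairing≡⇒pairing-ε≡ pos-cs pos (λ β → trans (sym (lin≡pairingPP pos-cs β)) (trans (sym (f≈ β)) (e β))) α ⟩
  pairing ds (λ μ → ε μ * PP μ α)     ∎

toPoly : List HookTerm → Poly
toPoly = map (λ h → proj₁ h , hook (proj₁ (proj₂ h)) (proj₂ (proj₂ h)))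

pairing-toPoly : ∀ hs φ → pairing (toPoly hs) φ ≡ combine hs (λ r l → φ (hook r l))
pairing-toPoly hs φ = ∑-map _ _ hs

replicate-positive : ∀ l → Positive (replicate l 1)
replicate-positive l = All.replicate⁺ l (s≤s z≤n)

toPoly-positive : ∀ hs → All (Positive ∘ proj₂) (toPoly hs)
toPoly-positive hs = All.map⁺ (All.universal (λ h → s≤s z≤n ∷ replicate-positive (proj₂ (proj₂ h))) hs)

evenRank : ℕ → Bool
evenRank r = not (isEven (suc r))

Odd⇒evenRank : ∀ m → Odd (suc m) → evenRank m ≡ true
Odd⇒evenRank m o rewrite o = refl

evenRank⇒Odd : ∀ m → evenRank m ≡ true → Odd (suc m)
evenRank⇒Odd m e with suc m % 2 | m%n<n (suc m) 2
evenRank⇒Odd m () | 0 | _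
... | 1 | _ = refl
... | suc (suc _) | s≤s (s≤s ())

ε-replicate : ∀ l → ε (replicate l 1) ≡ 1ℚ
ε-replicate zero    = refl
ε-replicate (suc l) = ε-replicate l

-- Parts equal to 1 do not affect the sign, so the average is a projection decided by the parity of
-- r + 1 alone.
½-hook : ∀ r l x → ½ * (x + ε (hook r l) * x) ≡ 𝟙 (evenRank r) * x
½-hook r l x rewrite ε-replicate l with isEven (suc r)
... | true  = solve 1 (λ x → con ½ :* (x :+ con (- 1ℚ) :* x) := con 0ℚ :* x) refl x
... | false = solve 1 (λ x → con ½ :* (x :+ con 1ℚ :* x) := con 1ℚ :* x) refl x

oddTerms : List HookTerm → List HookTerm
oddTerms = filterᵇ (evenRank ∘ proj₁ ∘ proj₂)

combine-oddTerms : ∀ hs T → combine hs (λ r l → 𝟙 (evenRank r) * T r l) ≡ combine (oddTerms hs) T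
combine-oddTerms []                  T = refl
combine-oddTerms ((q , r , l) ∷ hs) T with evenRank r
... | true  = cong₂ _+_ (cong (q *_) (ℚ.*-identityˡ (T r l))) (combine-oddTerms hs T)
... | false = trans (cong₂ _+_ (solve 2 (λ q t → q :* (con 0ℚ :* t) := con 0ℚ) refl q (T r l)) (combine-oddTerms hs T))
                    (ℚ.+-identityˡ (combine (oddTerms hs) T))

-- All that is remembered of a graph: a nonzero multiple of p_{m+1} plus terms divisible by p₁. The
-- condition r + l = m is homogeneity of degree m + 1, because a term (q , r , l) has the part r +
-- 1.
record HookExpansion {m} (G : Graph (suc m)) : Set where
  field
    lead      : ℚ
    tail      : List HookTerm
    lead≢0    : lead ≢ 0ℚ
    tail-size : All (λ h → proj₁ (proj₂ h) ℕ.+ proj₂ (proj₂ h) ≡ m × 1 ≤ proj₂ (proj₂ h)) tail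
    expansion : ∀ α → X G α ≡ combine ((lead , m , 0) ∷ tail) (λ r l → PP (hook r l) α)

sgn≢0 : ∀ m → sgn m ≢ 0ℚ
sgn≢0 zero    ()
sgn≢0 (suc m) e = sgn≢0 m (trans (solve 1 (λ x → x := :- (:- x)) refl (sgn m)) (cong -_ e))

starTail-size : ∀ m → All (λ h → proj₁ (proj₂ h) ℕ.+ proj₂ (proj₂ h) ≡ m × 1 ≤ proj₂ (proj₂ h)) (starTail m)
starTail-size zero    = []
starTail-size (suc m) = (ℕ.+-comm m 1 , s≤s z≤n) ∷ All.++⁺
  (All.map⁺ (All.map (λ {h} q → trans (ℕ.+-suc (proj₁ (proj₂ h)) (proj₂ (proj₂ h))) (cong suc (proj₁ q)) , s≤s z≤n) (starTail-size m)))
  (All.map⁺ (All.map (λ q → cong suc (proj₁ q) , proj₂ q) (starTail-size m)))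

star-expansion : ∀ m → HookExpansion (star (suc m))
star-expansion m = record
  { lead = sgn m ; tail = starTail m ; lead≢0 = sgn≢0 m ; tail-size = starTail-size m ; expansion = X-star m }

C3-expansion : HookExpansion C3
C3-expansion = record
  { lead = 1ℚ + 1ℚ ; tail = C3Tail ; lead≢0 = λ () ; tail-size = (refl , s≤s z≤n) ∷ (refl , s≤s z≤n) ∷ [] ; expansion = X-C3 }

B₁-expansion : ∀ m → HookExpansion (B₁ (suc m))
B₁-expansion 0                   = star-expansion 0
B₁-expansion 1                   = star-expansion 1
B₁-expansion 2                   = C3-expansion
B₁-expansion (suc (suc (suc m))) = star-expansion (3 ℕ.+ m)

module _ {m} {G : Graph (suc m)} (E : HookExpansion G) where
  open HookExpansion E

  private
    hooks : List HookTerm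
    hooks = (lead , m , 0) ∷ tail

    X≡pairing : ∀ α → X G α ≡ pairing (toPoly hooks) (λ μ → PP μ α)
    X≡pairing α = trans (expansion α) (sym (pairing-toPoly hooks (λ μ → PP μ α)))

  IsY-exists : ∃[ y ] IsY G y
  IsY-exists = _ , lin (twist (toPoly hooks)) pProd ,
    (toPoly hooks , toPoly-positive hooks ,
      (λ α → trans (X≡pairing α) (sym (lin≡pairingPP (toPoly-positive hooks) α))) , λ _ → refl) ,
    λ _ → refl

  IsY-expansion : Odd (suc m) → ∀ {y} → IsY G y →
    ∀ α → y α ≡ pairing ((lead , suc m ∷ []) ∷ toPoly (oddTerms tail)) (λ μ → PP μ α)
  IsY-expansion odd {y} (g , ω , y≈) α = begin
    y α                         ≡⟨ y≈ α ⟩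
    ½ * (X G α + g α)
      ≡⟨ cong₂ (λ x z → ½ * (x + z)) (expansion α)
           (trans (IsOmega⇒ (toPoly-positive hooks) X≡pairing ω α) (pairing-toPoly hooks (λ μ → ε μ * PP μ α))) ⟩
    ½ * (∑ hooks t + ∑ hooks u)        ≡⟨ cong (½ *_) (∑-+ t u hooks) ⟨
    ½ * ∑ hooks (λ h → t h + u h)      ≡⟨ ∑-*ˡ ½ (λ h → t h + u h) hooks ⟨
    ∑ hooks (λ h → ½ * (t h + u h))
      ≡⟨ ∑-cong hooks (λ (q , r , l) → trans
           (solve 4 (λ h q x e → h :* (q :* x :+ q :* (e :* x)) := q :* (h :* (x :+ e :* x))) refl ½ q (T r l) (ε (hook r l)))
           (cong (q *_) (½-hook r l (T r l)))) ⟩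
    combine hooks (λ r l → 𝟙 (evenRank r) * T r l)
      ≡⟨ cong₂ _+_ (cong (lead *_) (trans (cong (λ b → 𝟙 b * T m 0) (Odd⇒evenRank m odd)) (ℚ.*-identityˡ (T m 0))))
                   (trans (combine-oddTerms tail T) (sym (pairing-toPoly (oddTerms tail) (λ μ → PP μ α)))) ⟩
    pairing ((lead , suc m ∷ []) ∷ toPoly (oddTerms tail)) (λ μ → PP μ α) ∎
    where
    T : ℕ → ℕ → ℚ
    T r l = PP (hook r l) α
    t u : HookTerm → ℚ
    t (q , r , l) = q * T r l
    u (q , r , l) = q * (ε (hook r l) * T r l)

-- Oddness guards only `expansion`, so that a record exists for every k, including those where y is
-- unconstrained; `leadProd` and `tailProd` can then be defined on arbitrary lists.
record YExpansion (k : ℕ) (y : Series) : Set where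
  field
    lead      : ℚ
    tail      : Poly
    lead≢0    : lead ≢ 0ℚ
    tail-size : All (λ cl → All Odd (proj₂ cl) × sum (proj₂ cl) ≡ k × 2 ≤ length (proj₂ cl)) tail
    expansion : Odd k → ∀ α → y α ≡ pairing ((lead , k ∷ []) ∷ tail) (λ μ → PP μ α)

sum-replicate-1 : ∀ l → sum (replicate l 1) ≡ l
sum-replicate-1 zero    = refl
sum-replicate-1 (suc l) = cong suc (sum-replicate-1 l)

oddTerms-odd : ∀ hs → All (λ h → Odd (suc (proj₁ (proj₂ h)))) (oddTerms hs)
oddTerms-odd []                  = []
oddTerms-odd ((q , r , l) ∷ hs) with evenRank r in eq
... | true  = evenRank⇒Odd r eq ∷ oddTerms-odd hs
... | false = oddTerms-odd hs

oddTerms⁺ : ∀ {Q : HookTerm → Set} {hs} → All Q hs → All Q (oddTerms hs)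
oddTerms⁺ []                            = []
oddTerms⁺ {hs = (_ , r , _) ∷ _} (q ∷ qs) with evenRank r
... | true  = q ∷ oddTerms⁺ qs
... | false = oddTerms⁺ qs

YExpansion-IsY : ∀ {m} {G : Graph (suc m)} → HookExpansion G → ∀ {y} → (Odd (suc m) → IsY G y) → YExpansion (suc m) y
YExpansion-IsY {m} E isY = record
  { lead      = lead
  ; tail      = toPoly (oddTerms tail)
  ; lead≢0    = lead≢0
  ; tail-size = All.map⁺ (All.zipWith (λ {h} → size h) (oddTerms-odd tail , oddTerms⁺ tail-size))
  ; expansion = λ odd → IsY-expansion E odd (isY odd)
  }
  where
  open HookExpansion E
  size : ∀ h → Odd (suc (proj₁ (proj₂ h))) × (proj₁ (proj₂ h) ℕ.+ proj₂ (proj₂ h) ≡ m × 1 ≤ proj₂ (proj₂ h)) →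
         All Odd (hook (proj₁ (proj₂ h)) (proj₂ (proj₂ h))) ×
         sum (hook (proj₁ (proj₂ h)) (proj₂ (proj₂ h))) ≡ suc m × 2 ≤ length (hook (proj₁ (proj₂ h)) (proj₂ (proj₂ h)))
  size (q , r , l) (odd , r+l≡m , 1≤l) =
    odd ∷ All.replicate⁺ l refl ,
    cong suc (trans (cong (r ℕ.+_) (sum-replicate-1 l)) r+l≡m) ,
    s≤s (subst (1 ≤_) (sym (length-replicate l)) 1≤l)

-- Bases

Odd⇒Positive : ∀ {μ} → All Odd μ → Positive μ
Odd⇒Positive = All.map λ { {suc k} _ → s≤s z≤n }

length≤sum : ∀ {μ} → Positive μ → length μ ≤ sum μ
length≤sum []          = z≤n
length≤sum (1≤r ∷ pos) = ℕ.+-mono-≤ 1≤r (length≤sum pos)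

OP-length : ∀ {n μ} → OP n μ → length μ ≤ n
OP-length {μ = μ} (odd , _ , sum≡n) = subst (length μ ≤_) sum≡n (length≤sum (Odd⇒Positive odd))

OP-positive : ∀ {n} {cs : Poly} → All (OP n ∘ proj₂) cs → All (Positive ∘ proj₂) cs
OP-positive = All.map (λ op → Odd⇒Positive (proj₁ op))

OP-sort : ∀ {n μ} → All Odd μ → sum μ ≡ n → OP n (sort μ)
OP-sort {μ = μ} odd sum≡n = All-resp-↭ (↭-sym (sort-↭ μ)) odd , sort-↗ μ , trans (sum-↭ (sort-↭ μ)) sum≡n

*-≢0 : ∀ {a b} → a ≢ 0ℚ → b ≢ 0ℚ → a * b ≢ 0ℚ
*-≢0 a≢0 b≢0 ab≡0 = b≢0 (*-cancel-≢0 a≢0 ab≡0)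

mulTerm : ℚ × List ℕ → Poly → Poly
mulTerm cl = map (λ dn → proj₁ cl * proj₁ dn , proj₂ cl ++ proj₂ dn)

pairing-mulTerm : ∀ cl ds φ → pairing (mulTerm cl ds) φ ≡ proj₁ cl * pairing ds (λ ν → φ (proj₂ cl ++ ν))
pairing-mulTerm (c , μ) ds φ = trans (∑-map _ _ ds)
  (trans (∑-cong ds (λ dn → ℚ.*-assoc c (proj₁ dn) (φ (μ ++ proj₂ dn)))) (∑-*ˡ c _ ds))

pairing-*S : ∀ {f g} cs ds → (∀ α → f α ≡ pairing cs (λ μ → PP μ α)) → (∀ α → g α ≡ pairing ds (λ μ → PP μ α)) →
             ∀ α → (f *S g) α ≡ pairing (concatMap (λ cl → mulTerm cl ds) cs) (λ μ → PP μ α)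
pairing-*S {f} {g} cs ds f≈ g≈ α = begin
  (f *S g) α   ≡⟨ *S-cong {g = g} f≈ (λ _ → refl) α ⟩
  ((λ β → ∑ cs (λ cl → proj₁ cl * PP (proj₂ cl) β)) *S g) α
    ≡⟨ *S-linˡ proj₁ (λ cl → PP (proj₂ cl)) cs g α ⟩
  ∑ cs (λ cl → proj₁ cl * (PP (proj₂ cl) *S g) α)
    ≡⟨ ∑-cong cs (λ cl → trans (cong (proj₁ cl *_)
         (trans (PP-*S (proj₂ cl) g α) (trans (foldr-P-cong (proj₂ cl) g≈ α) (foldr-P-pairing (proj₂ cl) ds α))))
         (sym (pairing-mulTerm cl ds (λ μ → PP μ α)))) ⟩
  ∑ cs (λ cl → pairing (mulTerm cl ds) (λ μ → PP μ α))
    ≡⟨ ∑-concatMap (λ cl → mulTerm cl ds) _ cs ⟨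
  pairing (concatMap (λ cl → mulTerm cl ds) cs) (λ μ → PP μ α) ∎

-- When indices are distinct, a total coefficient is a single listed one; this converts vanishing of
-- functionals into the form required by `IndependentOP`.
pairing-δ-unique : ∀ {cs} → Unique (map proj₂ cs) → All (λ cl → pairing cs (δ (proj₂ cl)) ≡ proj₁ cl) cs
pairing-δ-unique {[]}           []             = []
pairing-δ-unique {(c , μ) ∷ cs} (fresh ∷ uniq) =
  head-δ ∷ All.zipWith (λ {cl} → tail-δ cl) (All.map⁻ fresh , pairing-δ-unique uniq)
  where
  head-δ : c * δ μ μ + pairing cs (δ μ) ≡ c
  head-δ = trans (cong₂ (λ x y → c * x + y) (δ-refl μ)
      (trans (∑-congAll (All.map (λ {cl} μ≢ → trans (cong (proj₁ cl *_) (δ-≢ (μ≢ ∘ sym))) (ℚ.*-zeroʳ (proj₁ cl))) (All.map⁻ fresh)))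
             (∑-zero cs)))
    (solve 1 (λ c → c :* con 1ℚ :+ con 0ℚ := c) refl c)
  tail-δ : ∀ cl → μ ≢ proj₂ cl × pairing cs (δ (proj₂ cl)) ≡ proj₁ cl → c * δ (proj₂ cl) μ + pairing cs (δ (proj₂ cl)) ≡ proj₁ cl
  tail-δ cl (μ≢ , e) = trans (cong₂ (λ x y → c * x + y) (δ-≢ μ≢) e)
    (solve 2 (λ c d → c :* con 0ℚ :+ d := d) refl c (proj₁ cl))

-- Triangularity of the products of the Y's

module Products (Y : ℕ → Series) (shape : ∀ k → YExpansion k (Y k)) where
  open YExpansion

  leadProd : List ℕ → ℚ
  leadProd []      = 1ℚ
  leadProd (k ∷ μ) = lead (shape k) * leadProd μ

  -- Arranged so that `expansionProd (k ∷ μ)` is definitionally the product list that `pairing-*S`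
  -- delivers.
  tailProd : List ℕ → Poly
  tailProd []      = []
  tailProd (k ∷ μ) = mulTerm (lead (shape k) , k ∷ []) (tailProd μ)
    ++ concatMap (λ cl → mulTerm cl ((leadProd μ , μ) ∷ tailProd μ)) (tail (shape k))

  expansionProd : List ℕ → Poly
  expansionProd μ = (leadProd μ , μ) ∷ tailProd μ

  leadProd≢0 : ∀ μ → leadProd μ ≢ 0ℚ
  leadProd≢0 []      = λ ()
  leadProd≢0 (k ∷ μ) = *-≢0 (lead≢0 (shape k)) (leadProd≢0 μ)

  prodY-expansion : ∀ {μ} → All Odd μ → ∀ α → prodY Y μ α ≡ pairing (expansionProd μ) (λ ν → PP ν α)
  prodY-expansion []                      α = solve 1 (λ x → x := con 1ℚ :* x :+ con 0ℚ) refl (oneS α)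
  prodY-expansion {k ∷ μ} (odd ∷ odds) α =
    pairing-*S ((lead (shape k) , k ∷ []) ∷ tail (shape k)) (expansionProd μ) (expansion (shape k) odd) (prodY-expansion odds) α

  Longer : List ℕ → ℚ × List ℕ → Set
  Longer μ cl = All Odd (proj₂ cl) × sum (proj₂ cl) ≡ sum μ × length μ < length (proj₂ cl)

  -- A tail term arises by taking a non-leading term from at least one factor, and such a term
  -- replaces a single part k by at least two.
  tailProd-longer : ∀ {μ} → All Odd μ → All (Longer μ) (tailProd μ)
  tailProd-longer []                      = []
  tailProd-longer {k ∷ μ} (odd ∷ odds) = All.++⁺
    (All.map⁺ (All.map (λ { (o , s , l) → odd ∷ o , cong (k ℕ.+_) s , s≤s l }) (tailProd-longer odds)))
    (All.concat⁺ (All.map⁺ (All.map (λ {cl} q → All.map⁺ (All.map (λ {dn} → longer cl q dn)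
      ((odds , refl , ℕ.≤-refl) ∷ All.map (λ { (o , s , l) → o , s , ℕ.<⇒≤ l }) (tailProd-longer odds)))) (tail-size (shape k)))))
    where
    longer : ∀ cl → All Odd (proj₂ cl) × sum (proj₂ cl) ≡ k × 2 ≤ length (proj₂ cl) →
             ∀ dn → All Odd (proj₂ dn) × sum (proj₂ dn) ≡ sum μ × length μ ≤ length (proj₂ dn) →
             Longer (k ∷ μ) (proj₁ cl * proj₁ dn , proj₂ cl ++ proj₂ dn)
    longer (_ , κ) (o , s , l) (_ , ν) (o′ , s′ , l′) =
      All.++⁺ o o′ , trans (sum-++ κ ν) (cong₂ ℕ._+_ s s′) ,
      subst (2 ℕ.+ length μ ≤_) (sym (length-++ κ)) (ℕ.+-mono-≤ l l′)

  sortedTail : List ℕ → Poly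
  sortedTail μ = sortTerms (tailProd μ)

  sortedTail-OP : ∀ {n μ} → OP n μ → All (λ cl → OP n (proj₂ cl) × length μ < length (proj₂ cl)) (sortedTail μ)
  sortedTail-OP {μ = μ} (odd , _ , sum≡n) = All.map⁺ (All.map
    (λ {cl} → λ { (o , s , l) → OP-sort o (trans s sum≡n) , subst (length μ <_) (sym (↭-length (sort-↭ (proj₂ cl)))) l })
    (tailProd-longer odd))

  prodY-sorted : ∀ {n μ} → OP n μ → ∀ α →
    prodY Y μ α ≡ pairing ((leadProd μ , μ) ∷ sortedTail μ) (λ ν → PP ν α)
  prodY-sorted {μ = μ} op α = trans (prodY-expansion (proj₁ op) α)
    (cong (leadProd μ * PP μ α +_) (sym (pairing-sortTerms (tailProd μ) (λ ν → PP ν α) (λ ν → PP-↭ (sort-↭ ν) α))))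

  prodY∈Γ : ∀ {n μ} → OP n μ → Γ n (prodY Y μ)
  prodY∈Γ {n} {μ} op = (leadProd μ , μ) ∷ sortedTail μ , ops ,
    λ α → trans (prodY-sorted op α) (sym (lin≡pairingPP (OP-positive ops) α))
    where
    ops : All (OP n ∘ proj₂) ((leadProd μ , μ) ∷ sortedTail μ)
    ops = op ∷ All.map proj₁ (sortedTail-OP op)

  -- p_μ is eliminated in favour of Y_μ and products p_ν with more factors; a partition of n has at most n parts.
  spanned : ∀ {n} N cs → All (λ cl → OP n (proj₂ cl) × n < N ℕ.+ length (proj₂ cl)) cs →
    ∃[ ds ] (All (OP n ∘ proj₂) ds × ∀ α → pairing cs (λ μ → PP μ α) ≡ pairing ds (λ μ → prodY Y μ α))
  spanned N       []              []                    = [] , [] , λ _ → refl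
  -- With `N` = 0 the bound asks for more than n positive parts of sum n.
  spanned zero    (_ ∷ _)         ((op , n<) ∷ _)       = contradiction (OP-length op) (ℕ.<⇒≱ n<)
  spanned {n} (suc N) ((c , μ) ∷ cs) ((op , n<) ∷ ops)
    with ds , ops-ds , e ← spanned N (sortedTail μ)
           (All.map (λ {cl} → λ { (opν , l) → opν , ℕ.<-≤-trans n<
             (subst (_≤ N ℕ.+ length (proj₂ cl)) (ℕ.+-suc N (length μ)) (ℕ.+-monoʳ-≤ N l)) }) (sortedTail-OP op))
       | ds′ , ops-ds′ , e′ ← spanned (suc N) cs ops
    -- Y_μ = a p_μ + tail is solved for c p_μ: it equals (c/a) Y_μ minus (c/a) times the tail, whose
    -- own expansion is `ds`.
    = (c * 1/ a , μ) ∷ scale (- (c * 1/ a)) ds ++ ds′ ,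
      op ∷ All.++⁺ (All.map⁺ ops-ds) ops-ds′ ,
      λ α → begin
        c * PP μ α + pairing cs (λ ν → PP ν α)
          ≡⟨ cong₂ _+_ (solved α) (e′ α) ⟩
        c * 1/ a * prodY Y μ α + - (c * 1/ a) * pairing (sortedTail μ) (λ ν → PP ν α) + pairing ds′ (λ ν → prodY Y ν α)
          ≡⟨ cong (λ x → c * 1/ a * prodY Y μ α + - (c * 1/ a) * x + pairing ds′ (λ ν → prodY Y ν α)) (e α) ⟩
        c * 1/ a * prodY Y μ α + - (c * 1/ a) * pairing ds (λ ν → prodY Y ν α) + pairing ds′ (λ ν → prodY Y ν α)
          ≡⟨ ℚ.+-assoc (c * 1/ a * prodY Y μ α) (- (c * 1/ a) * pairing ds (λ ν → prodY Y ν α)) _ ⟩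
        c * 1/ a * prodY Y μ α + (- (c * 1/ a) * pairing ds (λ ν → prodY Y ν α) + pairing ds′ (λ ν → prodY Y ν α))
          ≡⟨ cong (c * 1/ a * prodY Y μ α +_) (trans (∑-++ _ (scale (- (c * 1/ a)) ds) ds′)
               (cong (_+ pairing ds′ (λ ν → prodY Y ν α)) (pairing-scale (- (c * 1/ a)) ds (λ ν → prodY Y ν α)))) ⟨
        pairing ((c * 1/ a , μ) ∷ scale (- (c * 1/ a)) ds ++ ds′) (λ ν → prodY Y ν α) ∎
    where
    a = leadProd μ
    instance a-nonZero : ℚ.NonZero a
             a-nonZero = ≢-nonZero (leadProd≢0 μ)
    solved : ∀ α → c * PP μ α ≡ c * 1/ a * prodY Y μ α + - (c * 1/ a) * pairing (sortedTail μ) (λ ν → PP ν α)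
    solved α = begin
      c * PP μ α                  ≡⟨ solve 2 (λ c p → c :* p := c :* con 1ℚ :* p) refl c (PP μ α) ⟩
      c * 1ℚ * PP μ α             ≡⟨ cong (λ x → c * x * PP μ α) (ℚ.*-inverseˡ a) ⟨
      c * (1/ a * a) * PP μ α
        ≡⟨ solve 5 (λ c i a p t → c :* (i :* a) :* p := c :* i :* (a :* p :+ t) :+ :- (c :* i) :* t) refl
             c (1/ a) a (PP μ α) (pairing (sortedTail μ) (λ ν → PP ν α)) ⟩
      c * 1/ a * (a * PP μ α + pairing (sortedTail μ) (λ ν → PP ν α)) + - (c * 1/ a) * pairing (sortedTail μ) (λ ν → PP ν α)
        ≡⟨ cong (λ x → c * 1/ a * x + - (c * 1/ a) * pairing (sortedTail μ) (λ ν → PP ν α)) (prodY-sorted op α) ⟨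
      c * 1/ a * prodY Y μ α + - (c * 1/ a) * pairing (sortedTail μ) (λ ν → PP ν α) ∎

  Γ⊆span : ∀ {n} f → Γ n f → InSpanOP n (prodY Y) f
  Γ⊆span {n} f (cs , ops , f≈)
    with ds , ops-ds , e ← spanned (suc n) cs (All.map (λ op → op , s≤s (ℕ.m≤m+n n _)) ops)
    = ds , ops-ds , λ α → trans (f≈ α) (trans (lin≡pairingPP (OP-positive ops) α)
                            (trans (e α) (sym (lin≡pairing ds (prodY Y) α))))

  -- For decreasing ν, the coefficient of p_ν in Y_μ after the unsorted indices of the expansion are
  -- identified with their partitions.
  coefficient : List ℕ → List ℕ → ℚ
  coefficient ν μ = pairing (expansionProd μ) (δ ν ∘ sort)

  tail-coefficient : ∀ {ν μ} → All Odd μ → length ν ≤ length μ → pairing (tailProd μ) (δ ν ∘ sort) ≡ 0ℚ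
  tail-coefficient {ν} {μ} odd ν≤μ = trans (∑-congAll (All.map (λ {cl} → vanish cl) (tailProd-longer odd))) (∑-zero (tailProd μ))
    where
    vanish : ∀ cl → Longer μ cl → proj₁ cl * δ ν (sort (proj₂ cl)) ≡ 0ℚ
    vanish (c , κ) (_ , _ , μ<κ) = trans
      (cong (c *_) (δ-≢ {ν} {sort κ} λ { refl → ℕ.<⇒≱ μ<κ (subst (_≤ length μ) (↭-length (sort-↭ κ)) ν≤μ) })) (ℚ.*-zeroʳ c)

  -- A relation among the Y_μ is expanded into one among power sum products. Independence of the
  -- latter, tested with `δ ν ∘ sort`, makes the coefficient of each p_ν vanish, and triangular
  -- elimination then removes the Y_μ.
  independent : ∀ n → IndependentOP n (prodY Y)
  independent n cs ops uniq rel = All.map (λ {cl} e → trans (sym e) (vanishing (δ (proj₂ cl)))) (pairing-δ-unique uniq)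
    where
    expanded : Poly
    expanded = concatMap (λ cl → scale (proj₁ cl) (expansionProd (proj₂ cl))) cs
    pairing-expanded : ∀ φ → pairing expanded φ ≡ pairing cs (λ μ → pairing (expansionProd μ) φ)
    pairing-expanded φ = trans (∑-concatMap (λ cl → scale (proj₁ cl) (expansionProd (proj₂ cl))) _ cs)
      (∑-cong cs (λ cl → pairing-scale (proj₁ cl) (expansionProd (proj₂ cl)) φ))
    expanded-positive : All (Positive ∘ proj₂) expanded
    expanded-positive = All.concat⁺ (All.map⁺ (All.map (λ op → All.map⁺
      (Odd⇒Positive (proj₁ op) ∷ All.map (Odd⇒Positive ∘ proj₁) (tailProd-longer (proj₁ op)))) ops))
    expanded-zero : ∀ α → pairing expanded (λ μ → PP μ α) ≡ 0ℚ
    expanded-zero α = trans (pairing-expanded (λ μ → PP μ α))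
      (trans (∑-congAll (All.map (λ {cl} op → cong (proj₁ cl *_) (sym (prodY-expansion (proj₁ op) α))) ops))
             (trans (sym (lin≡pairing cs (prodY Y) α)) (rel α)))
    diagonal : ∀ {ν} → OP n ν → coefficient ν ν ≢ 0ℚ
    diagonal {ν} (odd , ↘ν , _) e = leadProd≢0 ν (trans (sym
      (trans (cong₂ (λ x y → leadProd ν * x + y) (trans (cong (δ ν) (sort-id ↘ν)) (δ-refl ν)) (tail-coefficient odd ℕ.≤-refl))
             (solve 1 (λ c → c :* con 1ℚ :+ con 0ℚ := c) refl (leadProd ν)))) e)
    -- Apart from p_μ itself, Y_μ contains only p_ν with ν longer than μ, so the rank has to fall as
    -- the length grows; `OP-length` keeps the truncated subtraction strict.
    triangular : ∀ {ν μ} → OP n ν → OP n μ → coefficient ν μ ≢ 0ℚ → μ ≡ ν ⊎ n ∸ length ν < n ∸ length μ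
    triangular {ν} {μ} opν (odd , ↘μ , _) ≢0 with μ ≟ᴸ ν | length μ ℕ.<? length ν
    ... | yes μ≡ν | _       = inj₁ μ≡ν
    ... | no _    | yes μ<ν = inj₂ (ℕ.∸-monoʳ-< μ<ν (OP-length opν))
    ... | no μ≢ν  | no μ≮ν  = contradiction
      (trans (cong₂ (λ x y → leadProd μ * x + y) (trans (cong (δ ν) (sort-id ↘μ)) (δ-≢ μ≢ν)) (tail-coefficient odd (ℕ.≮⇒≥ μ≮ν)))
             (solve 1 (λ c → c :* con 0ℚ :+ con 0ℚ := con 0ℚ) refl (leadProd μ))) ≢0
    vanishing : ∀ φ → pairing cs φ ≡ 0ℚ
    vanishing = triangular⇒pairing≡0 (OP n) coefficient (λ μ → n ∸ length μ) diagonal triangular ops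
      (λ {ν} _ → trans (sym (pairing-expanded (δ ν ∘ sort)))
        (pProd-independent expanded-positive expanded-zero (δ ν ∘ sort) (λ μ → cong (δ ν) (sort-id (sort-↗ μ)))))

  isBasis : ∀ n → IsBasisΓ n (prodY Y)
  isBasis n = (λ _ → prodY∈Γ) , Γ⊆span , independent n

hookExpansions⇒𝒴IsBasis : ∀ n {G : (k : ℕ) → Graph k} → (∀ m → HookExpansion (G (suc m))) → 𝒴IsBasis n G
hookExpansions⇒𝒴IsBasis n {G} E = exists , λ Y isY → Products.isBasis Y (shape Y isY) n
  where
  exists : ∀ k → Odd k → ∃[ y ] IsY (G k) y
  exists (suc m) _ = IsY-exists (E m)
  shape : ∀ Y → (∀ k → Odd k → IsY (G k) (Y k)) → ∀ k → YExpansion k (Y k)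
  -- A placeholder: 0 is not odd, so nothing is claimed about Y 0.
  shape Y isY zero    = record { lead = 1ℚ ; tail = [] ; lead≢0 = λ () ; tail-size = [] ; expansion = λ () }
  shape Y isY (suc m) = YExpansion-IsY (E m) (isY (suc m))

theorem3p9 : ∀ (n : ℕ) → 1 ≤ n → 𝒴IsBasis n B₁ × 𝒴IsBasis n B₂
theorem3p9 n _ = 
  hookExpansions⇒𝒴IsBasis n {B₁} B₁-expansion , hookExpansions⇒𝒴IsBasis n {B₂} star-expansion
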